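{- Let $c$, $k$ and $t$ be positive integers with $c\ge 3$ and $k\ge t+2$. Suppose $\mathcal{F}$ and $\mathcal{G}$ are cross $t$-intersecting subfamilies of $U^{[ck]}_{c,k}$ such that $|\mathcal{F}||\mathcal{G}|$ is maximum among all pairs of cross $t$-intersecting subfamilies of $U^{[ck]}_{c,k}$. If $c\ge 3+2\log_2 t$ or $k\ge 2t+2$, then $\mathcal{F}=\mathcal{G}=\{F\in U^{[ck]}_{c,k}: T\subseteq F\}$ for some $T\in U^{[ck]}_{c,t}$.
   Context: For positive integers $c,k,\ell$, $U^{[ck]}_{c,\ell}$ denotes the set of all families consisting of $\ell$ pairwise disjoint $c$-subsets ("blocks") of $[ck]=\{1,\dots,ck\}$; thus $U^{[ck]}_{c,k}$ is the set of $c$-uniform partitions of $[ck]$. Members are regarded as sets of blocks: for such $A,B$, $A\cap B$ is the set of common blocks, $|A\cap B|$ its number, and $A\subseteq B$ means every block of $A$ is a block of $B$. Two families $\mathcal{A}\subseteq U^{[ck]}_{c,\ell}$, $\mathcal{B}\subseteq U^{[ck]}_{c,m}$ are cross $t$-intersecting if $|A\cap B|\ge t$ for all $A\in\mathcal{A}$, $B\in\mathcal{B}$. -}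

module Defs where

open import Data.Nat using (ℕ; zero; suc; _+_; _*_)
open import Data.Bool using (Bool; true; false; if_then_else_; _∧_)
open import Data.Product using (_×_; _,_; Σ)
open import Data.Vec using (_∷_; [])
open import Data.Fin.Subset using (Subset; ∣_∣; _∩_; ⊥)
open import Data.List using (List; length)
open import Data.List.Relation.Unary.All using (All)
open import Data.List.Relation.Unary.Unique.Propositional using (Unique)
open import Relation.Binary.PropositionalEquality using (_≡_; _≢_)
open import Data.Nat using (_≤_)

-- A set of subsets of [n] (i.e. a set of candidate blocks), represented
-- canonically as a binary trie (so that ≡ is extensional equality of sets).
SetOfSubsets : ℕ → Set
SetOfSubsets zero = Bool
SetOfSubsets (suc n) = SetOfSubsets n × SetOfSubsets n

_∋_ : ∀ {n} → SetOfSubsets n → Subset n → Bool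
_∋_ {zero} b [] = b
_∋_ {suc n} (p , q) (false ∷ s) = p ∋ s
_∋_ {suc n} (p , q) (true ∷ s) = q ∋ s

size : ∀ {n} → SetOfSubsets n → ℕ
size {zero} b = if b then 1 else 0
size {suc n} (p , q) = size p + size q

_⊓_ : ∀ {n} → SetOfSubsets n → SetOfSubsets n → SetOfSubsets n
_⊓_ {zero} a b = a ∧ b
_⊓_ {suc n} (p , q) (p' , q') = (p ⊓ p') , (q ⊓ q')

_⊑_ : ∀ {n} → SetOfSubsets n → SetOfSubsets n → Set
A ⊑ B = ∀ s → A ∋ s ≡ true → B ∋ s ≡ true

InU : (n c ℓ : ℕ) → SetOfSubsets n → Set
InU n c ℓ A =
    (∀ s → A ∋ s ≡ true → ∣ s ∣ ≡ c)
  × (∀ s s' → A ∋ s ≡ true → A ∋ s' ≡ true → s ≢ s' → s ∩ s' ≡ ⊥)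
  × (size A ≡ ℓ)

-- A family of members of U^{[n]}_{c,ℓ}: a duplicate-free list (its size is its length)
Family : (n c ℓ : ℕ) → List (SetOfSubsets n) → Set
Family n c ℓ 𝓕 = Unique 𝓕 × All (InU n c ℓ) 𝓕

CrossInt : ∀ {n} → ℕ → List (SetOfSubsets n) → List (SetOfSubsets n) → Set
CrossInt t 𝓐 𝓑 = All (λ A → All (λ B → t ≤ size (A ⊓ B)) 𝓑) 𝓐

{-# OPTIONS --safe #-}
module Submission where

-- Write m = k - t and let u(p) be the number of c-uniform partitions of [cp], so
-- that u(p) = C(cp-1, c-1) u(p-1).  Call a packing of blocks a cover of a family
-- if it shares at least t blocks with every member; members of 𝓖 cover 𝓕 and
-- vice versa.  Let t+a and t+b be the least sizes of covers of 𝓕 and of 𝓖.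
-- Every G ∈ 𝓖 contains one of the C(t+b, t) t-subsets of a minimal cover of 𝓖.
-- A packing T ⊆ G with fewer than t+a blocks does not cover 𝓕, so some F ∈ 𝓕
-- forces into G one more block of F disjoint from T, for which there are at most
-- k-|T| choices.  Hence |𝓖| ≤ C(t+b, t) m(m-1)⋯(m-a+1) u(m-a), and symmetrically
-- for 𝓕.  In the product the factors regroup as h(a) h(b), where
-- h(a) = C(t+a, t) m(m-1)⋯(m-a+1) u(m-a), and the hypotheses on c, k, t give
-- h(a) < h(0) = u(m) for 1 ≤ a ≤ m.  A star attains u(m)², so a = b = 0 and
-- |𝓕| = |𝓖| = u(m): thus 𝓕 is the star of some T, and a member of 𝓖 without T
-- would force |𝓕| ≤ m u(m-1) < u(m).

open import Defs
open import Data.Bool using (Bool; true; false; _∧_; if_then_else_)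
import Data.Bool.Properties as Bool
open import Data.Empty using (⊥-elim)
open import Data.Fin using (Fin; zero; suc)
open import Data.Fin.Subset as Sub using (Subset; ∣_∣; _∩_; _∪_; ∁; ⊥; ⊤; ⋃)
import Data.Fin.Subset.Properties as Sub
open import Data.List using (List; []; _∷_; [_]; _++_; length; map; filter; concatMap)
open import Data.List.Membership.Propositional using (_∈_; _∉_; find)
open import Data.List.Membership.Propositional.Properties using (∈-map⁺; ∈-map⁻; ∈-++⁺ˡ; ∈-++⁺ʳ; ∈-++⁻; ∈-filter⁺; ∈-filter⁻; ∈-∃++; ∈-concatMap⁻)
open import Data.List.Properties using (length-map; length-++; filter-accept; filter-reject; filter-complete; length-filter)
open import Data.List.Relation.Unary.All as All using (All; []; _∷_)
import Data.List.Relation.Unary.All.Properties as All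
open import Data.List.Relation.Unary.AllPairs as AllPairs using (AllPairs; []; _∷_)
import Data.List.Relation.Unary.AllPairs.Properties as AllPairs
open import Data.List.Relation.Unary.Any using (here; there)
open import Data.List.Relation.Unary.Unique.Propositional using (Unique)
import Data.List.Relation.Unary.Unique.Propositional.Properties as Unique
open import Data.Nat hiding (_⊓_)
open import Data.Nat.Combinatorics using (_C_; nCk+nC[k+1]≡[n+1]C[k+1]; k>n⇒nCk≡0; nC1≡n; nCn≡1; nCk≡nC[n∸k])
open import Data.Nat.Properties
open import Data.Nat.Tactic.RingSolver using (solve-∀)
open import Data.Product using (_×_; _,_; Σ; ∃; proj₁; proj₂)
open import Data.Product.Properties using (≡-dec)
open import Data.Sum using (_⊎_; inj₁; inj₂; map₂)
open import Data.Vec using ([]; _∷_; here; there)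
open import Data.Vec.Properties using (∷-injectiveʳ) renaming (≡-dec to Vec-≡-dec)
open import Function using (_∘_)
open import Function.Bundles using (_⇔_; mk⇔)
open import Relation.Binary.Definitions using (DecidableEquality)
open import Relation.Binary.PropositionalEquality using (_≡_; _≢_; refl; sym; trans; cong; cong₂; subst; module ≡-Reasoning)
open import Relation.Nullary using (¬_; Dec; yes; no; does)
open import Relation.Nullary.Decidable using (_×-dec_; dec-true; map′)
open import Relation.Unary using (Decidable)
open import Relation.Unary.Properties using (∁?)

private
  variable
    X Y : Set
    n : ℕ

-- Binomial coefficients and the numerical estimate

-- Pascal's rule and induction on `n`. In this form ratios of binomials can be used without
-- division.
C-absorb : ∀ n k → suc k * (suc n C suc k) ≡ suc n * (n C k)
C-absorb zero zero = refl
C-absorb zero (suc k) = trans (cong (suc (suc k) *_) (k>n⇒nCk≡0 {1} {2 + k} (s≤s (s≤s z≤n)))) (*-zeroʳ (suc (suc k)))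
C-absorb (suc n) zero = trans (cong (1 *_) (nC1≡n (2 + n))) (*-comm 1 (2 + n))
C-absorb (suc n) (suc k) = begin
  suc (suc k) * (suc (suc n) C suc (suc k))
    ≡⟨ cong (suc (suc k) *_) (nCk+nC[k+1]≡[n+1]C[k+1] (suc n) (suc k)) ⟨
  suc (suc k) * (x + (suc n C suc (suc k)))
    ≡⟨ *-distribˡ-+ (suc (suc k)) x _ ⟩
  (x + suc k * x) + suc (suc k) * (suc n C suc (suc k))
    ≡⟨ cong₂ (λ y z → (x + y) + z) (C-absorb n k) (C-absorb n (suc k)) ⟩
  (x + suc n * (n C k)) + suc n * (n C suc k)
    ≡⟨ +-assoc x _ _ ⟩
  x + (suc n * (n C k) + suc n * (n C suc k))
    ≡⟨ cong (x +_) (*-distribˡ-+ (suc n) (n C k) _) ⟨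
  x + suc n * (n C k + n C suc k)
    ≡⟨ cong (λ y → x + suc n * y) (nCk+nC[k+1]≡[n+1]C[k+1] n k) ⟩
  suc (suc n) * x ∎
  where
  open ≡-Reasoning
  x = suc n C suc k

C-sym : ∀ a t → (a + t) C t ≡ (a + t) C a
C-sym a t = trans (nCk≡nC[n∸k] (m≤n+m t a)) (cong ((a + t) C_) (m+n∸n≡m a t))

-- Symmetry moves `suc a` into the lower index, where absorption applies. This is the ratio by which
-- the binomial in h(a) grows with a.
C-absorb-top : ∀ a t → suc a * ((suc a + t) C t) ≡ (suc a + t) * ((a + t) C t)
C-absorb-top a t = begin
  suc a * ((suc a + t) C t)      ≡⟨ cong (suc a *_) (C-sym (suc a) t) ⟩
  suc a * ((suc a + t) C suc a)  ≡⟨ C-absorb (a + t) a ⟩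
  (suc a + t) * ((a + t) C a)    ≡⟨ cong ((suc a + t) *_) (C-sym a t) ⟨
  (suc a + t) * ((a + t) C t)    ∎
  where open ≡-Reasoning

-- Blocks have size suc d; a set of suc d * suc p points has blockCount d p
-- blocks through a fixed point.
blockCount : ℕ → ℕ → ℕ
blockCount d p = (d + suc d * p) C d

partitionCount : ℕ → ℕ → ℕ
partitionCount d zero = 1
partitionCount d (suc p) = blockCount d p * partitionCount d p

-- (a + p)(a + p - 1)⋯(p + 1)
falling : ℕ → ℕ → ℕ
falling zero p = 1
falling (suc a) p = suc (a + p) * falling a p

-- Peels off the smallest factor instead of the largest, so that a + p stays fixed as in the passage
-- from h(a) to h(a + 1).
falling-snoc : ∀ a p → falling (suc a) p ≡ falling a (suc p) * suc p
falling-snoc zero p = trans (*-identityʳ (suc p)) (sym (*-identityˡ (suc p)))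
falling-snoc (suc a) p = begin
  suc (suc a + p) * falling (suc a) p
    ≡⟨ cong (suc (suc a + p) *_) (falling-snoc a p) ⟩
  suc (suc a + p) * (falling a (suc p) * suc p)
    ≡⟨ *-assoc (suc (suc a + p)) (falling a (suc p)) (suc p) ⟨
  suc (suc a + p) * falling a (suc p) * suc p
    ≡⟨ cong (λ y → suc y * falling a (suc p) * suc p) (+-suc a p) ⟨
  falling (suc a) (suc p) * suc p ∎
  where open ≡-Reasoning

-- The number h(a) of the header, with m = a + p.
coverBound : ℕ → ℕ → ℕ → ℕ → ℕ
coverBound d t a p = ((a + t) C t) * (falling a p * partitionCount d p)

coverBound-zero : ∀ d t p → coverBound d t 0 p ≡ partitionCount d p
coverBound-zero d t p = begin
  (t C t) * (1 * partitionCount d p) ≡⟨ cong₂ _*_ (nCn≡1 t) (*-identityˡ _) ⟩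
  1 * partitionCount d p             ≡⟨ *-identityˡ _ ⟩
  partitionCount d p                 ∎
  where open ≡-Reasoning

-- With m = a + 1 + p fixed, the step from h(a) to h(a + 1) trades a factor `blockCount d p` of u
-- for a factor p + 1 of the falling product. The ratio is stated with denominators cleared.
coverBound-suc : ∀ d t a p →
  suc a * blockCount d p * coverBound d t (suc a) p ≡ (suc a + t) * suc p * coverBound d t a (suc p)
coverBound-suc d t a p = begin
  suc a * r * (x * (falling (suc a) p * u))
    ≡⟨ cong (λ y → suc a * r * (x * (y * u))) (falling-snoc a p) ⟩
  suc a * r * (x * (f * suc p * u))
    ≡⟨ shuffle (suc a) r x f (suc p) u ⟩
  suc a * x * suc p * (f * (r * u))
    ≡⟨ cong (λ y → y * suc p * (f * (r * u))) (C-absorb-top a t) ⟩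
  (suc a + t) * ((a + t) C t) * suc p * (f * (r * u))
    ≡⟨ shuffle′ (suc a + t) ((a + t) C t) (suc p) (f * (r * u)) ⟩
  (suc a + t) * suc p * coverBound d t a (suc p) ∎
  where
  open ≡-Reasoning
  r = blockCount d p
  x = (suc a + t) C t
  f = falling a (suc p)
  u = partitionCount d p
  shuffle : ∀ a r x f p u → a * r * (x * (f * p * u)) ≡ a * x * p * (f * (r * u))
  shuffle = solve-∀
  shuffle′ : ∀ a b c d → a * b * c * d ≡ a * c * (b * d)
  shuffle′ = solve-∀

*-cancelˡ-scaled-≤ : ∀ {x y} r s → x ≤ y → y * r ≤ x * s → 1 ≤ x → r ≤ s
*-cancelˡ-scaled-≤ {suc x} {y} r s x≤y yr≤xs _ = *-cancelˡ-≤ (suc x) (≤-trans (*-monoˡ-≤ r x≤y) yr≤xs)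

-- Lower bounds for the number of blocks through a point

module Growth (d p : ℕ) where

  N : ℕ
  N = suc d * p

  -- A chain of binomials rising from 1 to `term d`, which is `blockCount d p`.
  term : ℕ → ℕ
  term j = (j + N) C j

  -- By absorption consecutive terms have ratio (j + 1 + N)/(j + 1), and N ≥ (j + 1)p because j ≤ d.
  term-suc : ∀ j → j ≤ d → suc p * term j ≤ term (suc j)
  term-suc j j≤d = *-cancelˡ-≤ (suc j) (begin
    suc j * (suc p * term j)   ≡⟨ *-assoc (suc j) (suc p) (term j) ⟨
    suc j * suc p * term j     ≤⟨ *-monoˡ-≤ (term j) (≤-trans (≤-reflexive (*-suc (suc j) p)) (+-monoʳ-≤ (suc j) (*-monoˡ-≤ p (s≤s j≤d)))) ⟩
    (suc j + N) * term j       ≡⟨ C-absorb (j + N) j ⟨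
    suc j * term (suc j)       ∎)
    where open ≤-Reasoning

  ^≤term : ∀ j → j ≤ d → suc p ^ j ≤ term j
  ^≤term zero _ = ≤-refl
  ^≤term (suc j) j<d = ≤-trans (*-monoʳ-≤ (suc p) (^≤term j (<⇒≤ j<d))) (term-suc j (<⇒≤ j<d))

  term-mono : ∀ i j → i + j ≤ d → term i ≤ term (j + i)
  term-mono i zero _ = ≤-refl
  term-mono i (suc j) le = ≤-trans (term-mono i j (<⇒≤ le′))
    (≤-trans (m≤n*m (term (j + i)) (suc p)) (term-suc (j + i) (subst (_≤ d) (+-comm i j) (<⇒≤ le′))))
    where
    le′ : i + j < d
    le′ = subst (_≤ d) (+-suc i j) le

  2*square≤term2 : 1 ≤ p → 2 ≤ d → 2 * (suc p * suc p) ≤ term 2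
  2*square≤term2 (s≤s {_} {q} z≤n) 2≤d = *-cancelˡ-≤ 2 (begin
    -- The added polynomial is the exact gap to (2 + 3p)(1 + 3p) for p = q + 1; it remains to use N
    -- ≥ 3p.
    2 * (2 * (suc p * suc p))     ≤⟨ m≤m+n _ (5 * q * q + 11 * q + 4) ⟩
    2 * (2 * (suc p * suc p)) + (5 * q * q + 11 * q + 4) ≡⟨ poly q ⟩
    (2 + 3 * p) * (1 + 3 * p)     ≤⟨ *-mono-≤ (+-monoʳ-≤ 2 3p≤N) (+-monoʳ-≤ 1 3p≤N) ⟩
    (2 + N) * (1 + N)             ≡⟨ cong ((2 + N) *_) (nC1≡n (1 + N)) ⟨
    (2 + N) * term 1              ≡⟨ C-absorb (1 + N) 1 ⟨
    2 * term 2                    ∎)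
    where
    open ≤-Reasoning
    3p≤N : 3 * p ≤ N
    3p≤N = *-monoˡ-≤ p (s≤s 2≤d)
    poly : ∀ q → 2 * (2 * (suc (suc q) * suc (suc q))) + (5 * q * q + 11 * q + 4)
               ≡ (2 + 3 * suc q) * (1 + 3 * suc q)
    poly = solve-∀

  2*square≤blockCount : 1 ≤ p → 2 ≤ d → 2 * (suc p * suc p) ≤ blockCount d p
  2*square≤blockCount 1≤p 2≤d = ≤-trans (2*square≤term2 1≤p 2≤d)
    (subst (λ x → term 2 ≤ term x) (m∸n+n≡m 2≤d)
      (term-mono 2 (d ∸ 2) (≤-reflexive (m+[n∸m]≡n 2≤d))))

  ^≤blockCount : suc p ^ d ≤ blockCount d p
  ^≤blockCount = ^≤term d ≤-refl

  1≤blockCount : 1 ≤ blockCount d p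
  1≤blockCount = ≤-trans (m^n>0 (suc p) d) ^≤blockCount

open Growth using (2*square≤blockCount; ^≤blockCount; 1≤blockCount)

blockCount-zero : ∀ d → blockCount d 0 ≡ 1
blockCount-zero d = trans (cong (λ x → (d + x) C d) (*-zeroʳ d)) (trans (cong (_C d) (+-identityʳ d)) (nCn≡1 d))

1≤partitionCount : ∀ d p → 1 ≤ partitionCount d p
1≤partitionCount d zero = ≤-refl
1≤partitionCount d (suc p) = *-mono-≤ (1≤blockCount d p) (1≤partitionCount d p)

1≤falling : ∀ a p → 1 ≤ falling a p
1≤falling zero p = ≤-refl
1≤falling (suc a) p = *-mono-≤ {1} {suc (a + p)} (s≤s z≤n) (1≤falling a p)

1≤C : ∀ a t → 1 ≤ (a + t) C t
1≤C zero t = ≤-reflexive (sym (nCn≡1 t))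
1≤C (suc a) t = *-cancelˡ-< (suc a) 0 _ (begin-strict
  suc a * 0                    ≡⟨ *-zeroʳ (suc a) ⟩
  0                            <⟨ *-mono-≤ {1} {suc a + t} (s≤s z≤n) (1≤C a t) ⟩
  (suc a + t) * ((a + t) C t)  ≡⟨ C-absorb-top a t ⟨
  suc a * ((suc a + t) C t)    ∎)
  where open ≤-Reasoning

1≤coverBound : ∀ d t a p → 1 ≤ coverBound d t a p
1≤coverBound d t a p = *-mono-≤ (1≤C a t) (*-mono-≤ (1≤falling a p) (1≤partitionCount d p))

-- For t < m, h at least halves at every step but the last (p = 0), where it
-- less than doubles.
module ManyBlocks (d t : ℕ) (2≤d : 2 ≤ d) where

  -- The ratio h(a + 1)/h(a) is (a + 1 + t)(p + 2) over (a + 1)r, where r ≥ 2(p + 2)². Since t ≤ a +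
  -- p + 1, twice the numerator is at most 2(a + 1)(p + 2)².
  halves : ∀ a p → t ≤ a + suc p → 2 * coverBound d t (suc a) (suc p) ≤ coverBound d t a (2 + p)
  halves a p t≤m = *-cancelˡ-scaled-≤ {(suc a + t) * (2 + p) * 2} (2 * h) h′ key (≤-reflexive eq) (s≤s z≤n)
    where
    open ≤-Reasoning
    h = coverBound d t (suc a) (suc p)
    h′ = coverBound d t a (2 + p)
    r = blockCount d (suc p)
    poly : ∀ a p → (suc a + (a + suc p)) * (2 + p) * 2 + 2 * a * p * (2 + p) ≡ suc a * (2 * ((2 + p) * (2 + p)))
    poly = solve-∀
    shuffle : ∀ a r h → a * r * (2 * h) ≡ 2 * (a * r * h)
    shuffle = solve-∀
    shuffle′ : ∀ x y h → 2 * (x * y * h) ≡ x * y * 2 * h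
    shuffle′ = solve-∀
    key : (suc a + t) * (2 + p) * 2 ≤ suc a * r
    key = begin
      (suc a + t) * (2 + p) * 2                          ≤⟨ *-monoˡ-≤ 2 (*-monoˡ-≤ (2 + p) (+-monoʳ-≤ (suc a) t≤m)) ⟩
      (suc a + (a + suc p)) * (2 + p) * 2                ≤⟨ m≤m+n _ (2 * a * p * (2 + p)) ⟩
      (suc a + (a + suc p)) * (2 + p) * 2 + 2 * a * p * (2 + p) ≡⟨ poly a p ⟩
      suc a * (2 * ((2 + p) * (2 + p)))                  ≤⟨ *-monoʳ-≤ (suc a) (2*square≤blockCount d (suc p) (s≤s z≤n) 2≤d) ⟩
      suc a * r                                          ∎
    eq : suc a * r * (2 * h) ≡ (suc a + t) * (2 + p) * 2 * h′
    eq = trans (shuffle (suc a) r h) (trans (cong (2 *_) (coverBound-suc d t a (suc p))) (shuffle′ (suc a + t) (2 + p) h′))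

  -- At p = 0 the block count is 1, so the ratio is (a + 1 + t)/(a + 1), which is below 2 when t ≤
  -- a.
  last<double : ∀ a → t ≤ a → coverBound d t (suc a) 0 < 2 * coverBound d t a 1
  last<double a t≤a = *-cancelˡ-< (suc a) _ _ (begin-strict
    suc a * h                             ≡⟨ cong (_* h) (trans (cong (suc a *_) (blockCount-zero d)) (*-identityʳ (suc a))) ⟨
    suc a * blockCount d 0 * h            ≡⟨ coverBound-suc d t a 0 ⟩
    (suc a + t) * 1 * h′                  ≡⟨ cong (_* h′) (*-identityʳ (suc a + t)) ⟩
    (suc a + t) * h′                      <⟨ *-monoˡ-< h′ {{>-nonZero (1≤coverBound d t a 1)}} (+-monoʳ-< (suc a) (s≤s t≤a)) ⟩
    (suc a + suc a) * h′                  ≡⟨ shuffle (suc a) h′ ⟩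
    suc a * (2 * h′)                      ∎)
    where
    open ≤-Reasoning
    h = coverBound d t (suc a) 0
    h′ = coverBound d t a 1
    shuffle : ∀ a h → (a + a) * h ≡ a * (2 * h)
    shuffle = solve-∀

  -- Chains the halvings back to h(0). One factor 2 is kept in reserve for the final step, which may
  -- nearly double h.
  half : ∀ a p → t ≤ a + suc p → 2 * coverBound d t (suc a) (suc p) ≤ partitionCount d (suc a + suc p)
  half zero p t≤ = ≤-trans (halves zero p t≤) (≤-reflexive (coverBound-zero d t (2 + p)))
  half (suc a) p t≤ = begin
    2 * coverBound d t (2 + a) (suc p)       ≤⟨ halves (suc a) p t≤ ⟩
    coverBound d t (suc a) (2 + p)           ≤⟨ m≤n*m _ 2 ⟩
    2 * coverBound d t (suc a) (2 + p)       ≤⟨ half a (suc p) (subst (t ≤_) (sym (+-suc a (suc p))) t≤) ⟩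
    partitionCount d (suc a + (2 + p))       ≡⟨ cong (partitionCount d) (+-suc (suc a) (suc p)) ⟩
    partitionCount d (2 + a + suc p)         ∎
    where open ≤-Reasoning

  bound : ∀ a p → 1 ≤ a → t < a + p → 2 ≤ a + p → coverBound d t a p < partitionCount d (a + p)
  bound (suc a) (suc p) _ (s≤s t≤) _ =
    ≤-trans (m<m+n _ (subst (0 <_) (sym (+-identityʳ _)) (1≤coverBound d t (suc a) (suc p)))) (half a p t≤)
  bound (suc zero) zero _ _ (s≤s ())
  -- Here h(m) < 2h(m - 1) ≤ u(m); the reserved factor 2 is spent.
  bound (suc (suc a)) zero _ (s≤s t≤) _ = <-≤-trans
    (last<double (suc a) (subst (t ≤_) (+-identityʳ (suc a)) t≤))
    (subst (λ x → 2 * coverBound d t (suc a) 1 ≤ partitionCount d x) eq (half a 0 (subst (t ≤_) (trans (+-identityʳ (suc a)) (+-comm 1 a)) t≤)))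
    where
    eq : suc a + 1 ≡ 2 + a + 0
    eq = trans (+-comm (suc a) 1) (sym (+-identityʳ (2 + a)))

-- For t ≥ m, h decreases at every step but the last, and the last two steps
-- together decrease it; both follow from C(cp-1, c-1) ≥ p^(c-1).
module LargeBlocks (e t : ℕ) (2≤t : 2 ≤ t) (t²≤2^e : t * t ≤ 2 ^ e) where

  d : ℕ
  d = 2 + e

  private
    t′ = t ∸ 2
    t≡ : 2 + t′ ≡ t
    t≡ = m+[n∸m]≡n 2≤t

  -- Serves a single step, as `poly₂` serves the last two together. Substituting t = 2 + t′ makes
  -- the difference a polynomial in t′ with nonnegative coefficients.
  poly₁ : suc t < 2 * (t * t)
  poly₁ = subst (λ t → suc t < 2 * (t * t)) t≡ (subst (suc (3 + t′) ≤_) (eq t′) (m≤m+n (4 + t′) _))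
    where
    eq : ∀ s → 4 + s + (4 + 7 * s + 2 * s * s) ≡ 2 * ((2 + s) * (2 + s))
    eq = solve-∀

  poly₂ : (2 + t) * (1 + t) < 4 * (t * t)
  poly₂ = subst (λ t → (2 + t) * (1 + t) < 4 * (t * t)) t≡ (subst (suc ((4 + t′) * (3 + t′)) ≤_) (eq t′) (m≤m+n _ _))
    where
    eq : ∀ s → suc ((4 + s) * (3 + s)) + (3 + 9 * s + 3 * s * s) ≡ 4 * ((2 + s) * (2 + s))
    eq = solve-∀

  -- In r ≥ (p + 2)^(e + 2) the part (p + 2)^e pays for t²; of the two remaining factors one matches
  -- p + 2 and the other pays for the 2 in t + 1 < 2t².
  shrinks : ∀ a p → coverBound d t (suc a) (suc p) < coverBound d t a (2 + p)
  shrinks a p = *-cancelˡ-< (suc a * r) _ _ (begin-strict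
    suc a * r * h                  ≡⟨ coverBound-suc d t a (suc p) ⟩
    (suc a + t) * (2 + p) * h′     <⟨ *-monoˡ-< h′ {{>-nonZero (1≤coverBound d t a (2 + p))}} key ⟩
    suc a * r * h′                 ∎)
    where
    open ≤-Reasoning
    h = coverBound d t (suc a) (suc p)
    h′ = coverBound d t a (2 + p)
    r = blockCount d (suc p)
    poly : ∀ a t → suc a + t + a * t ≡ suc a * suc t
    poly = solve-∀
    shuffle : ∀ x y z → x * (2 * y) * z ≡ x * (z * (2 * y))
    shuffle = solve-∀
    key : (suc a + t) * (2 + p) < suc a * r
    key = begin-strict
      (suc a + t) * (2 + p)                ≤⟨ *-monoˡ-≤ (2 + p) (≤-trans (m≤m+n _ (a * t)) (≤-reflexive (poly a t))) ⟩
      suc a * suc t * (2 + p)              <⟨ *-monoˡ-< (2 + p) (*-monoʳ-< (suc a) poly₁) ⟩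
      suc a * (2 * (t * t)) * (2 + p)      ≡⟨ shuffle (suc a) (t * t) (2 + p) ⟩
      suc a * ((2 + p) * (2 * (t * t)))    ≤⟨ *-monoʳ-≤ (suc a) (*-monoʳ-≤ (2 + p) (*-mono-≤ {2} {2 + p} (s≤s (s≤s z≤n)) (≤-trans t²≤2^e (^-monoˡ-≤ e (s≤s (s≤s z≤n)))))) ⟩
      suc a * (2 + p) ^ d                  ≤⟨ *-monoʳ-≤ (suc a) (^≤blockCount d (suc p)) ⟩
      suc a * r                            ∎

  -- The step to p = 0 has block count 1 and may increase h. It is therefore multiplied with the
  -- step before it, whose block count is at least 2^(e + 2) ≥ 4t².
  last-two : ∀ a → coverBound d t (2 + a) 0 < coverBound d t a 2
  last-two a = *-cancelˡ-< ((2 + a) * (suc a * r)) _ _ (begin-strict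
    (2 + a) * (suc a * r) * h          ≡⟨ shuffle (2 + a) (suc a * r) h ⟩
    suc a * r * ((2 + a) * h)          ≡⟨ cong (λ x → suc a * r * (x * h)) (trans (cong ((2 + a) *_) (blockCount-zero d)) (*-identityʳ (2 + a))) ⟨
    suc a * r * ((2 + a) * blockCount d 0 * h)   ≡⟨ cong (suc a * r *_) (coverBound-suc d t (suc a) 0) ⟩
    suc a * r * ((2 + a + t) * 1 * h₁)  ≡⟨ shuffle₁ (suc a * r) (2 + a + t) h₁ ⟩
    (2 + a + t) * (suc a * r * h₁)      ≡⟨ cong ((2 + a + t) *_) (coverBound-suc d t a 1) ⟩
    (2 + a + t) * ((suc a + t) * 2 * h₂)  ≡⟨ shuffle₂ (2 + a + t) (suc a + t) h₂ ⟩
    (2 + a + t) * 2 * (suc a + t) * h₂  <⟨ *-monoˡ-< h₂ {{>-nonZero (1≤coverBound d t a 2)}} key ⟩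
    (2 + a) * (suc a * r) * h₂         ∎)
    where
    open ≤-Reasoning
    h = coverBound d t (2 + a) 0
    h₁ = coverBound d t (1 + a) 1
    h₂ = coverBound d t a 2
    r = blockCount d 1
    shuffle : ∀ x y h → x * y * h ≡ y * (x * h)
    shuffle = solve-∀
    shuffle₁ : ∀ x y h → x * (y * 1 * h) ≡ y * (x * h)
    shuffle₁ = solve-∀
    shuffle₂ : ∀ x y h → x * (y * 2 * h) ≡ x * 2 * y * h
    shuffle₂ = solve-∀
    shuffle₃ : ∀ x y u v → x * u * (y * v) ≡ x * y * (u * v)
    shuffle₃ = solve-∀
    shuffle₄ : ∀ y → 4 * y ≡ 2 * (2 * y)
    shuffle₄ = solve-∀
    poly : ∀ a t → suc a + t + a * t ≡ suc a * suc t
    poly = solve-∀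
    poly′ : ∀ a t → (2 + a + t) * 2 + a * t ≡ (2 + a) * (2 + t)
    poly′ = solve-∀
    key : (2 + a + t) * 2 * (suc a + t) < (2 + a) * (suc a * r)
    key = begin-strict
      (2 + a + t) * 2 * (suc a + t)            ≤⟨ *-mono-≤ (≤-trans (m≤m+n _ (a * t)) (≤-reflexive (poly′ a t))) (≤-trans (m≤m+n _ (a * t)) (≤-reflexive (poly a t))) ⟩
      (2 + a) * (2 + t) * (suc a * suc t)      ≡⟨ shuffle₃ (2 + a) (suc a) (2 + t) (suc t) ⟩
      (2 + a) * suc a * ((2 + t) * (1 + t))    <⟨ *-monoʳ-< ((2 + a) * suc a) poly₂ ⟩
      (2 + a) * suc a * (4 * (t * t))          ≡⟨ *-assoc (2 + a) (suc a) _ ⟩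
      (2 + a) * (suc a * (4 * (t * t)))        ≤⟨ *-monoʳ-≤ (2 + a) (*-monoʳ-≤ (suc a) (*-monoʳ-≤ 4 t²≤2^e)) ⟩
      (2 + a) * (suc a * (4 * 2 ^ e))          ≡⟨ cong (λ x → (2 + a) * (suc a * x)) (shuffle₄ (2 ^ e)) ⟩
      (2 + a) * (suc a * 2 ^ d)                ≤⟨ *-monoʳ-≤ (2 + a) (*-monoʳ-≤ (suc a) (^≤blockCount d 1)) ⟩
      (2 + a) * (suc a * r)                    ∎

  weak : ∀ a p → 1 ≤ p → coverBound d t a p ≤ partitionCount d (a + p)
  weak zero p _ = ≤-reflexive (coverBound-zero d t p)
  weak (suc a) (suc p) _ = ≤-trans (<⇒≤ (shrinks a p))
    (subst (λ x → coverBound d t a (2 + p) ≤ partitionCount d x) (+-suc a (suc p)) (weak a (2 + p) (s≤s z≤n)))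

  bound : ∀ a p → 1 ≤ a → 2 ≤ a + p → coverBound d t a p < partitionCount d (a + p)
  bound (suc a) (suc p) _ _ = <-≤-trans (shrinks a p)
    (subst (λ x → coverBound d t a (2 + p) ≤ partitionCount d x) (+-suc a (suc p)) (weak a (2 + p) (s≤s z≤n)))
  bound (suc zero) zero _ (s≤s ())
  bound (suc (suc a)) zero _ _ = <-≤-trans (last-two a)
    (subst (λ x → coverBound d t a 2 ≤ partitionCount d x) (trans (+-comm a 2) (sym (+-identityʳ (2 + a)))) (weak a 2 (s≤s z≤n)))

coverBound<partitionCount : ∀ e t m → 2 ≤ m → t * t ≤ 2 ^ e ⊎ t < m →
  ∀ a p → a + p ≡ m → 1 ≤ a → coverBound (2 + e) t a p < partitionCount (2 + e) m
coverBound<partitionCount e t m 2≤m (inj₂ t<m) a p refl 1≤a = ManyBlocks.bound (2 + e) t (s≤s (s≤s z≤n)) a p 1≤a t<m 2≤m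
-- The estimate for large blocks requires t ≥ 2, which 2 ≤ m ≤ t supplies; when t < m the estimate
-- for many blocks applies.
coverBound<partitionCount e t m 2≤m (inj₁ t²≤) a p refl 1≤a with ≤-<-connex m t
... | inj₁ m≤t = LargeBlocks.bound e t (≤-trans 2≤m m≤t) t²≤ a p 1≤a 2≤m
... | inj₂ t<m = ManyBlocks.bound (2 + e) t (s≤s (s≤s z≤n)) a p 1≤a t<m 2≤m

-- Counting in lists

Unique-⊆⇒length-≤ : ∀ {xs ys : List X} → Unique xs → (∀ {x} → x ∈ xs → x ∈ ys) → length xs ≤ length ys
Unique-⊆⇒length-≤ [] _ = z≤n
Unique-⊆⇒length-≤ {xs = x ∷ xs} (x∉xs ∷ uniq) sub with ∈-∃++ (sub (here refl))
... | as , bs , refl = begin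
  suc (length xs)            ≤⟨ s≤s (Unique-⊆⇒length-≤ uniq sub′) ⟩
  suc (length (as ++ bs))    ≡⟨ cong suc (length-++ as) ⟩
  suc (length as + length bs) ≡⟨ +-suc (length as) (length bs) ⟨
  length as + suc (length bs) ≡⟨ length-++ as ⟨
  length (as ++ x ∷ bs)      ∎
  where
  open ≤-Reasoning
  sub′ : ∀ {y} → y ∈ xs → y ∈ as ++ bs
  sub′ y∈xs with ∈-++⁻ as (sub (there y∈xs))
  ... | inj₁ y∈as = ∈-++⁺ˡ y∈as
  ... | inj₂ (here y≡x) = ⊥-elim (All.lookup x∉xs y∈xs (sym y≡x))
  ... | inj₂ (there y∈bs) = ∈-++⁺ʳ as y∈bs

Unique⇒AllPairs : ∀ {R : X → X → Set} {xs} → Unique xs → (∀ {x y} → x ∈ xs → y ∈ xs → x ≢ y → R x y) → AllPairs R xs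
Unique⇒AllPairs [] _ = []
Unique⇒AllPairs (x∉xs ∷ uniq) rel =
  All.tabulate (λ y∈xs → rel (here refl) (there y∈xs) (All.lookup x∉xs y∈xs))
  ∷ Unique⇒AllPairs uniq (λ x∈ y∈ → rel (there x∈) (there y∈))

-- A cardinality bound on a predicate, stated through lists so that classes of partitions can be
-- bounded without first being enumerated.
AtMost : ℕ → (X → Set) → Set
AtMost b P = ∀ xs → Unique xs → (∀ {x} → x ∈ xs → P x) → length xs ≤ b

AtMost-⊆ : ∀ {b} {P Q : X → Set} → (∀ {x} → P x → Q x) → AtMost b Q → AtMost b P
AtMost-⊆ sub bound xs uniq all = bound xs uniq (sub ∘ all)

AtMost-≤ : ∀ {a b} {P : X → Set} → a ≤ b → AtMost a P → AtMost b P
AtMost-≤ a≤b bound xs uniq all = ≤-trans (bound xs uniq all) a≤b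

AtMost-1 : {P : X → Set} → (∀ {x y} → P x → P y → x ≡ y) → AtMost 1 P
AtMost-1 same [] _ _ = z≤n
AtMost-1 same (x ∷ []) _ _ = ≤-refl
AtMost-1 same (x ∷ y ∷ xs) ((x≢y ∷ _) ∷ _) all = ⊥-elim (x≢y (same (all (here refl)) (all (there (here refl)))))

length-filter-∁ : {Q : X → Set} (Q? : Decidable Q) (xs : List X) →
  length xs ≡ length (filter Q? xs) + length (filter (∁? Q?) xs)
length-filter-∁ Q? [] = refl
length-filter-∁ Q? (x ∷ xs) with does (Q? x)
... | true = cong suc (length-filter-∁ Q? xs)
... | false = trans (cong suc (length-filter-∁ Q? xs)) (sym (+-suc _ _))

AtMost-+ : ∀ {a b} {P Q : X → Set} (Q? : Decidable Q) →
  AtMost a (λ x → P x × Q x) → AtMost b (λ x → P x × ¬ Q x) → AtMost (a + b) P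
AtMost-+ Q? bound bound′ xs uniq all = ≤-trans (≤-reflexive (length-filter-∁ Q? xs)) (+-mono-≤
  (bound _ (Unique.filter⁺ Q? uniq) (λ x∈ → let x∈xs , q = ∈-filter⁻ Q? x∈ in all x∈xs , q))
  (bound′ _ (Unique.filter⁺ (∁? Q?) uniq) (λ x∈ → let x∈xs , q = ∈-filter⁻ (∁? Q?) x∈ in all x∈xs , q)))

-- The classes may overlap: each element is charged to the first class in `ys` that contains it, so
-- the tail only has to cover what the head misses.
AtMost-⋃ : ∀ {b} {P : X → Set} {R : Y → X → Set} (R? : ∀ y → Decidable (R y)) ys →
  (∀ {x} → P x → ∃ λ y → y ∈ ys × R y x) →
  (∀ {y} → y ∈ ys → AtMost b (λ x → P x × R y x)) → AtMost (length ys * b) P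
AtMost-⋃ R? [] cov bound [] _ _ = z≤n
AtMost-⋃ R? [] cov bound (x ∷ xs) _ all with cov (all (here refl))
... | _ , () , _
AtMost-⋃ {P = P} {R} R? (y ∷ ys) cov bound = AtMost-+ (R? y) (bound (here refl))
  (AtMost-⋃ R? ys cov′ (λ y∈ → AtMost-⊆ (λ ((p , _) , r) → p , r) (bound (there y∈))))
  where
  cov′ : ∀ {x} → P x × ¬ R y x → ∃ λ z → z ∈ ys × R z x
  cov′ (p , ¬r) with cov p
  ... | _ , here refl , r = ⊥-elim (¬r r)
  ... | z , there z∈ , r = z , z∈ , r

-- Sets of blocks

elems : SetOfSubsets n → List (Subset n)
elems {zero} b = if b then [ [] ] else []
elems {suc n} (p , q) = map (false ∷_) (elems p) ++ map (true ∷_) (elems q)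

length-elems : (A : SetOfSubsets n) → length (elems A) ≡ size A
length-elems {zero} true = refl
length-elems {zero} false = refl
length-elems {suc n} (p , q) = trans (length-++ (map (false ∷_) (elems p)))
  (cong₂ _+_ (trans (length-map _ (elems p)) (length-elems p)) (trans (length-map _ (elems q)) (length-elems q)))

elems-Unique : (A : SetOfSubsets n) → Unique (elems A)
elems-Unique {zero} true = [] ∷ []
elems-Unique {zero} false = []
elems-Unique {suc n} (p , q) = Unique.++⁺
  (Unique.map⁺ ∷-injectiveʳ (elems-Unique p)) (Unique.map⁺ ∷-injectiveʳ (elems-Unique q)) disj
  where
  disj : ∀ {s} → ¬ (s ∈ map (false ∷_) (elems p) × s ∈ map (true ∷_) (elems q))
  disj (s∈p , s∈q) with ∈-map⁻ _ s∈p | ∈-map⁻ _ s∈q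
  ... | _ , _ , refl | _ , _ , ()

∈-elems⁺ : (A : SetOfSubsets n) {s : Subset n} → A ∋ s ≡ true → s ∈ elems A
∈-elems⁺ {zero} true {[]} _ = here refl
∈-elems⁺ {suc n} (p , q) {false ∷ s} eq = ∈-++⁺ˡ (∈-map⁺ _ (∈-elems⁺ p eq))
∈-elems⁺ {suc n} (p , q) {true ∷ s} eq = ∈-++⁺ʳ _ (∈-map⁺ _ (∈-elems⁺ q eq))

∈-elems⁻ : (A : SetOfSubsets n) {s : Subset n} → s ∈ elems A → A ∋ s ≡ true
∈-elems⁻ {zero} true {[]} _ = refl
∈-elems⁻ {suc n} (p , q) s∈ with ∈-++⁻ (map (false ∷_) (elems p)) s∈
... | inj₁ s∈p with ∈-map⁻ _ s∈p
...   | _ , s′∈ , refl = ∈-elems⁻ p s′∈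
∈-elems⁻ {suc n} (p , q) s∈ | inj₂ s∈q with ∈-map⁻ _ s∈q
...   | _ , s′∈ , refl = ∈-elems⁻ q s′∈

∋-ext : (A B : SetOfSubsets n) → (∀ s → A ∋ s ≡ B ∋ s) → A ≡ B
∋-ext {zero} A B eq = eq []
∋-ext {suc n} (p , q) (p′ , q′) eq =
  cong₂ _,_ (∋-ext p p′ (λ s → eq (false ∷ s))) (∋-ext q q′ (λ s → eq (true ∷ s)))

⊑-antisym : {A B : SetOfSubsets n} → A ⊑ B → B ⊑ A → A ≡ B
⊑-antisym {A = A} {B} A⊑B B⊑A = ∋-ext A B λ s → Bool-antisym (A⊑B s) (B⊑A s)
  where
  Bool-antisym : ∀ {x y} → (x ≡ true → y ≡ true) → (y ≡ true → x ≡ true) → x ≡ y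
  Bool-antisym {true} f _ = sym (f refl)
  Bool-antisym {false} {true} _ g = g refl
  Bool-antisym {false} {false} _ _ = refl

⊓-∋ : (A B : SetOfSubsets n) (s : Subset n) → (A ⊓ B) ∋ s ≡ A ∋ s ∧ B ∋ s
⊓-∋ {zero} A B [] = refl
⊓-∋ {suc n} (p , q) (p′ , q′) (false ∷ s) = ⊓-∋ p p′ s
⊓-∋ {suc n} (p , q) (p′ , q′) (true ∷ s) = ⊓-∋ q q′ s

⊓-∋⁺ : (A B : SetOfSubsets n) {s : Subset n} → A ∋ s ≡ true → B ∋ s ≡ true → (A ⊓ B) ∋ s ≡ true
⊓-∋⁺ A B {s} a b = trans (⊓-∋ A B s) (cong₂ _∧_ a b)

⊓-∋⁻ : (A B : SetOfSubsets n) {s : Subset n} → (A ⊓ B) ∋ s ≡ true → A ∋ s ≡ true × B ∋ s ≡ true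
⊓-∋⁻ A B {s} eq with A ∋ s | B ∋ s | trans (sym (⊓-∋ A B s)) eq
... | true | true | _ = refl , refl

size-⊓-comm : (A B : SetOfSubsets n) → size (A ⊓ B) ≡ size (B ⊓ A)
size-⊓-comm A B = cong size (⊑-antisym (swap A B) (swap B A))
  where
  swap : ∀ {n} (A B : SetOfSubsets n) → (A ⊓ B) ⊑ (B ⊓ A)
  swap A B s eq = let a , b = ⊓-∋⁻ A B eq in ⊓-∋⁺ B A b a

_≟ᵀ_ : DecidableEquality (SetOfSubsets n)
_≟ᵀ_ {zero} = Bool._≟_
_≟ᵀ_ {suc n} = ≡-dec _≟ᵀ_ _≟ᵀ_

_≟ˢ_ : DecidableEquality (Subset n)
_≟ˢ_ = Vec-≡-dec Bool._≟_

tabulate : (Subset n → Bool) → SetOfSubsets n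
tabulate {zero} f = f []
tabulate {suc n} f = tabulate (λ s → f (false ∷ s)) , tabulate (λ s → f (true ∷ s))

tabulate-∋ : (f : Subset n → Bool) (s : Subset n) → tabulate f ∋ s ≡ f s
tabulate-∋ {zero} f [] = refl
tabulate-∋ {suc n} f (false ∷ s) = tabulate-∋ (λ s → f (false ∷ s)) s
tabulate-∋ {suc n} f (true ∷ s) = tabulate-∋ (λ s → f (true ∷ s)) s

module _ {n : ℕ} where
  open import Data.List.Membership.DecPropositional (_≟ˢ_ {n}) public using () renaming (_∈?_ to _∈ˢ?_)

fromList : List (Subset n) → SetOfSubsets n
fromList Ts = tabulate (λ s → does (s ∈ˢ? Ts))

∈-fromList⁺ : {Ts : List (Subset n)} {s : Subset n} → s ∈ Ts → fromList Ts ∋ s ≡ true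
∈-fromList⁺ {Ts = Ts} {s} s∈ = trans (tabulate-∋ _ s) (dec-true (s ∈ˢ? Ts) s∈)

∈-fromList⁻ : (Ts : List (Subset n)) {s : Subset n} → fromList Ts ∋ s ≡ true → s ∈ Ts
∈-fromList⁻ Ts {s} eq with s ∈ˢ? Ts | trans (sym (tabulate-∋ (λ s → does (s ∈ˢ? Ts)) s)) eq
... | yes s∈ | _ = s∈

size-fromList : {Ts : List (Subset n)} → Unique Ts → size (fromList Ts) ≡ length Ts
size-fromList {Ts = Ts} uniq = trans (sym (length-elems (fromList Ts))) (≤-antisym
  (Unique-⊆⇒length-≤ (elems-Unique (fromList Ts)) (λ s∈ → ∈-fromList⁻ Ts (∈-elems⁻ (fromList Ts) s∈)))
  (Unique-⊆⇒length-≤ uniq (λ s∈ → ∈-elems⁺ (fromList Ts) (∈-fromList⁺ s∈))))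

-- Packings are kept as lists, since they grow one block at a time, while partitions stay tries,
-- where equality is extensional. This and `common` compare the two.
Contains : List (Subset n) → SetOfSubsets n → Set
Contains Ts A = All (λ s → A ∋ s ≡ true) Ts

∋? : (s : Subset n) → Decidable (λ A → A ∋ s ≡ true)
∋? s A = A ∋ s Bool.≟ true

common : List (Subset n) → SetOfSubsets n → ℕ
common Ts A = length (filter (λ s → ∋? s A) Ts)

-- Packings by disjoint blocks

Disjoint : Subset n → Subset n → Set
Disjoint s s′ = s ∩ s′ ≡ ⊥

Disjoint-⁻ : {s s′ : Subset n} → Disjoint s s′ → ∀ {x} → x Sub.∈ s → x Sub.∉ s′
Disjoint-⁻ eq x∈s x∈s′ = Sub.∉⊥ (subst (_ Sub.∈_) eq (Sub.x∈p∩q⁺ (x∈s , x∈s′)))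

Disjoint-⁺ : {s s′ : Subset n} → (∀ {x} → x Sub.∈ s → x Sub.∉ s′) → Disjoint s s′
Disjoint-⁺ {s = s} {s′} f = Sub.Empty-unique λ (x , x∈) → let x∈s , x∈s′ = Sub.x∈p∩q⁻ s s′ x∈ in f x∈s x∈s′

Disjoint-sym : {s s′ : Subset n} → Disjoint s s′ → Disjoint s′ s
Disjoint-sym {s = s} {s′} = trans (Sub.∩-comm s′ s)

∣∪∣-Disjoint : (p q : Subset n) → Disjoint p q → ∣ p ∪ q ∣ ≡ ∣ p ∣ + ∣ q ∣
∣∪∣-Disjoint [] [] _ = refl
∣∪∣-Disjoint (false ∷ p) (false ∷ q) eq = ∣∪∣-Disjoint p q (∷-injectiveʳ eq)
∣∪∣-Disjoint (false ∷ p) (true ∷ q) eq = trans (cong suc (∣∪∣-Disjoint p q (∷-injectiveʳ eq))) (sym (+-suc _ _))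
∣∪∣-Disjoint (true ∷ p) (false ∷ q) eq = cong suc (∣∪∣-Disjoint p q (∷-injectiveʳ eq))
∣∪∣-Disjoint (true ∷ p) (true ∷ q) ()

∈-⋃⁺ : {Ts : List (Subset n)} {s : Subset n} {x : Fin n} → s ∈ Ts → x Sub.∈ s → x Sub.∈ ⋃ Ts
∈-⋃⁺ (here refl) x∈s = Sub.x∈p∪q⁺ (inj₁ x∈s)
∈-⋃⁺ (there s∈) x∈s = Sub.x∈p∪q⁺ (inj₂ (∈-⋃⁺ s∈ x∈s))

∈-⋃⁻ : (Ts : List (Subset n)) {x : Fin n} → x Sub.∈ ⋃ Ts → ∃ λ s → s ∈ Ts × x Sub.∈ s
∈-⋃⁻ [] x∈ = ⊥-elim (Sub.∉⊥ x∈)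
∈-⋃⁻ (s ∷ Ts) x∈ with Sub.x∈p∪q⁻ s (⋃ Ts) x∈
... | inj₁ x∈s = s , here refl , x∈s
... | inj₂ x∈Ts = let s′ , s′∈ , x∈s′ = ∈-⋃⁻ Ts x∈Ts in s′ , there s′∈ , x∈s′

Packing : ℕ → List (Subset n) → Set
Packing c Ts = All (λ s → ∣ s ∣ ≡ c) Ts × AllPairs Disjoint Ts

Packing-∷ : ∀ {c} {s : Subset n} {Ts} → ∣ s ∣ ≡ c → All (Disjoint s) Ts → Packing c Ts → Packing c (s ∷ Ts)
Packing-∷ ∣s∣ dis (sizes , pairs) = ∣s∣ ∷ sizes , dis ∷ pairs

∣⋃∣-Packing : ∀ {c} {Ts : List (Subset n)} → Packing c Ts → ∣ ⋃ Ts ∣ ≡ length Ts * c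
∣⋃∣-Packing {n} {Ts = []} _ = Sub.∣⊥∣≡0 n
∣⋃∣-Packing {Ts = s ∷ Ts} (∣s∣ ∷ sizes , dis ∷ pairs) =
  trans (∣∪∣-Disjoint s (⋃ Ts) (Disjoint-⁺ λ x∈s x∈⋃ → let s′ , s′∈ , x∈s′ = ∈-⋃⁻ Ts x∈⋃ in Disjoint-⁻ (All.lookup dis s′∈) x∈s x∈s′))
    (cong₂ _+_ ∣s∣ (∣⋃∣-Packing (sizes , pairs)))

-- A block equal to one disjoint from it would be empty, against its positive size.
Packing-Unique : ∀ {d} {Ts : List (Subset n)} → Packing (suc d) Ts → Unique Ts
Packing-Unique {Ts = []} _ = []
Packing-Unique {n} {Ts = s ∷ Ts} (∣s∣ ∷ sizes , dis ∷ pairs) = All.map distinct dis ∷ Packing-Unique (sizes , pairs)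
  where
  distinct : ∀ {s′} → Disjoint s s′ → s ≢ s′
  distinct eq refl with trans (sym ∣s∣) (trans (cong ∣_∣ (trans (sym (Sub.∩-idem s)) eq)) (Sub.∣⊥∣≡0 n))
  ... | ()

InU-fromList : ∀ {d} {Ts : List (Subset n)} → Packing (suc d) Ts → InU n (suc d) (length Ts) (fromList Ts)
InU-fromList {Ts = Ts} pack@(sizes , pairs) =
  (λ s eq → All.lookup sizes (∈-fromList⁻ Ts eq)) ,
  (λ s s′ eq eq′ → lookup pairs (∈-fromList⁻ Ts eq) (∈-fromList⁻ Ts eq′)) ,
  size-fromList (Packing-Unique pack)
  where
  lookup : ∀ {Ts} {s s′} → AllPairs Disjoint Ts → s ∈ Ts → s′ ∈ Ts → s ≢ s′ → Disjoint s s′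
  lookup (dis ∷ pairs) (here refl) (here refl) s≢s = ⊥-elim (s≢s refl)
  lookup (dis ∷ pairs) (here refl) (there s′∈) _ = All.lookup dis s′∈
  lookup (dis ∷ pairs) (there s∈) (here refl) _ = Disjoint-sym (All.lookup dis s∈)
  lookup (dis ∷ pairs) (there s∈) (there s′∈) s≢s′ = lookup pairs s∈ s′∈ s≢s′

elems-Packing : ∀ {c ℓ} {A : SetOfSubsets n} → InU n c ℓ A → Packing c (elems A)
elems-Packing {A = A} (sizes , dis , _) =
  All.tabulate (λ s∈ → sizes _ (∈-elems⁻ A s∈)) ,
  Unique⇒AllPairs (elems-Unique A) (λ s∈ s′∈ → dis _ _ (∈-elems⁻ A s∈) (∈-elems⁻ A s′∈))

InU-Disjoint : ∀ {c ℓ} {A : SetOfSubsets n} {s Ts} → InU n c ℓ A → A ∋ s ≡ true → s ∉ Ts → Contains Ts A → All (Disjoint s) Ts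
InU-Disjoint (_ , dis , _) A∋s s∉ con = All.tabulate λ s′∈ → dis _ _ A∋s (All.lookup con s′∈) λ { refl → s∉ s′∈ }

-- Blocks through a point

subsetsOf : Subset n → ℕ → List (Subset n)
subsetsOf [] zero = [ [] ]
subsetsOf [] (suc c) = []
subsetsOf (false ∷ W) c = map (false ∷_) (subsetsOf W c)
subsetsOf (true ∷ W) zero = map (false ∷_) (subsetsOf W zero)
subsetsOf (true ∷ W) (suc c) = map (true ∷_) (subsetsOf W c) ++ map (false ∷_) (subsetsOf W (suc c))

length-subsetsOf : (W : Subset n) (c : ℕ) → length (subsetsOf W c) ≡ ∣ W ∣ C c
length-subsetsOf [] zero = refl
length-subsetsOf [] (suc c) = refl
length-subsetsOf (false ∷ W) c = trans (length-map _ (subsetsOf W c)) (length-subsetsOf W c)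
length-subsetsOf (true ∷ W) zero = trans (length-map _ (subsetsOf W zero)) (length-subsetsOf W zero)
length-subsetsOf (true ∷ W) (suc c) = trans (length-++ (map (true ∷_) (subsetsOf W c))) (trans
  (cong₂ _+_ (trans (length-map _ (subsetsOf W c)) (length-subsetsOf W c))
             (trans (length-map _ (subsetsOf W (suc c))) (length-subsetsOf W (suc c))))
  (nCk+nC[k+1]≡[n+1]C[k+1] ∣ W ∣ c))

subsetsOf-Unique : (W : Subset n) (c : ℕ) → Unique (subsetsOf W c)
subsetsOf-Unique [] zero = [] ∷ []
subsetsOf-Unique [] (suc c) = []
subsetsOf-Unique (false ∷ W) c = Unique.map⁺ ∷-injectiveʳ (subsetsOf-Unique W c)
subsetsOf-Unique (true ∷ W) zero = Unique.map⁺ ∷-injectiveʳ (subsetsOf-Unique W zero)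
subsetsOf-Unique (true ∷ W) (suc c) = Unique.++⁺
  (Unique.map⁺ ∷-injectiveʳ (subsetsOf-Unique W c)) (Unique.map⁺ ∷-injectiveʳ (subsetsOf-Unique W (suc c))) disj
  where
  disj : ∀ {s} → ¬ (s ∈ map (true ∷_) (subsetsOf W c) × s ∈ map (false ∷_) (subsetsOf W (suc c)))
  disj (s∈p , s∈q) with ∈-map⁻ _ s∈p | ∈-map⁻ _ s∈q
  ... | _ , _ , refl | _ , _ , ()

∈-subsetsOf⁺ : {W s : Subset n} {c : ℕ} → s Sub.⊆ W → ∣ s ∣ ≡ c → s ∈ subsetsOf W c
∈-subsetsOf⁺ {W = []} {[]} _ refl = here refl
∈-subsetsOf⁺ {W = false ∷ W} {false ∷ s} s⊆W eq = ∈-map⁺ _ (∈-subsetsOf⁺ (Sub.drop-∷-⊆ s⊆W) eq)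
∈-subsetsOf⁺ {W = false ∷ W} {true ∷ s} s⊆W eq with s⊆W here
... | ()
∈-subsetsOf⁺ {W = true ∷ W} {false ∷ s} {zero} s⊆W eq = ∈-map⁺ _ (∈-subsetsOf⁺ (Sub.drop-∷-⊆ s⊆W) eq)
∈-subsetsOf⁺ {W = true ∷ W} {false ∷ s} {suc c} s⊆W eq = ∈-++⁺ʳ _ (∈-map⁺ _ (∈-subsetsOf⁺ (Sub.drop-∷-⊆ s⊆W) eq))
∈-subsetsOf⁺ {W = true ∷ W} {true ∷ s} {suc c} s⊆W eq = ∈-++⁺ˡ (∈-map⁺ _ (∈-subsetsOf⁺ (Sub.drop-∷-⊆ s⊆W) (suc-injective eq)))

∈-subsetsOf⁻ : (W : Subset n) (c : ℕ) {s : Subset n} → s ∈ subsetsOf W c → s Sub.⊆ W × ∣ s ∣ ≡ c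
∈-subsetsOf⁻ [] zero (here refl) = Sub.⊆-refl , refl
∈-subsetsOf⁻ (false ∷ W) c s∈ with ∈-map⁻ _ s∈
... | s′ , s′∈ , refl = let s⊆ , eq = ∈-subsetsOf⁻ W c s′∈ in Sub.out⊆ s⊆ , eq
∈-subsetsOf⁻ (true ∷ W) zero s∈ with ∈-map⁻ _ s∈
... | s′ , s′∈ , refl = let s⊆ , eq = ∈-subsetsOf⁻ W zero s′∈ in Sub.out⊆ s⊆ , eq
∈-subsetsOf⁻ (true ∷ W) (suc c) s∈ with ∈-++⁻ (map (true ∷_) (subsetsOf W c)) s∈
... | inj₁ s∈₁ with ∈-map⁻ _ s∈₁
...   | s′ , s′∈ , refl = let s⊆ , eq = ∈-subsetsOf⁻ W c s′∈ in Sub.in⊆in s⊆ , cong suc eq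
∈-subsetsOf⁻ (true ∷ W) (suc c) s∈ | inj₂ s∈₂ with ∈-map⁻ _ s∈₂
...   | s′ , s′∈ , refl = let s⊆ , eq = ∈-subsetsOf⁻ W (suc c) s′∈ in Sub.out⊆ s⊆ , eq

-- The subsets of W of size suc d that contain the least element of W.
leastBlocks : Subset n → ℕ → List (Subset n)
leastBlocks [] d = []
leastBlocks (false ∷ W) d = map (false ∷_) (leastBlocks W d)
leastBlocks (true ∷ W) d = map (true ∷_) (subsetsOf W d)

length-leastBlocks : (W : Subset n) (d : ℕ) {w : ℕ} → ∣ W ∣ ≡ suc w → length (leastBlocks W d) ≡ w C d
length-leastBlocks (false ∷ W) d eq = trans (length-map _ (leastBlocks W d)) (length-leastBlocks W d eq)
length-leastBlocks (true ∷ W) d eq = trans (length-map _ (subsetsOf W d))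
  (trans (length-subsetsOf W d) (cong (_C d) (suc-injective eq)))

leastBlocks-Unique : (W : Subset n) (d : ℕ) → Unique (leastBlocks W d)
leastBlocks-Unique [] d = []
leastBlocks-Unique (false ∷ W) d = Unique.map⁺ ∷-injectiveʳ (leastBlocks-Unique W d)
leastBlocks-Unique (true ∷ W) d = Unique.map⁺ ∷-injectiveʳ (subsetsOf-Unique W d)

-- Only the existence of a common point x is exported: it forces some listed block into every
-- partition, and no two of them into the same one.
∈-leastBlocks : (W : Subset n) (d : ℕ) {w : ℕ} → ∣ W ∣ ≡ suc w → ∃ λ x → x Sub.∈ W ×
  (∀ {s} → s Sub.⊆ W → ∣ s ∣ ≡ suc d → x Sub.∈ s → s ∈ leastBlocks W d) ×
  (∀ {s} → s ∈ leastBlocks W d → x Sub.∈ s × s Sub.⊆ W × ∣ s ∣ ≡ suc d)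
∈-leastBlocks (false ∷ W) d eq with ∈-leastBlocks W d eq
... | x , x∈W , into , from = suc x , there x∈W , into′ , from′
  where
  into′ : ∀ {s} → s Sub.⊆ false ∷ W → ∣ s ∣ ≡ suc d → suc x Sub.∈ s → s ∈ leastBlocks (false ∷ W) d
  into′ {false ∷ s} s⊆ ∣s∣ (there x∈) = ∈-map⁺ _ (into (Sub.drop-∷-⊆ s⊆) ∣s∣ x∈)
  into′ {true ∷ s} s⊆ ∣s∣ x∈ with s⊆ here
  ... | ()
  from′ : ∀ {s} → s ∈ leastBlocks (false ∷ W) d → suc x Sub.∈ s × s Sub.⊆ false ∷ W × ∣ s ∣ ≡ suc d
  from′ s∈ with ∈-map⁻ _ s∈
  ... | s′ , s′∈ , refl = let x∈ , s⊆ , ∣s∣ = from s′∈ in there x∈ , Sub.out⊆ s⊆ , ∣s∣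
∈-leastBlocks (true ∷ W) d eq = zero , here , into , from
  where
  into : ∀ {s} → s Sub.⊆ true ∷ W → ∣ s ∣ ≡ suc d → zero Sub.∈ s → s ∈ leastBlocks (true ∷ W) d
  into s⊆ ∣s∣ here = ∈-map⁺ _ (∈-subsetsOf⁺ (Sub.drop-∷-⊆ s⊆) (suc-injective ∣s∣))
  from : ∀ {s} → s ∈ leastBlocks (true ∷ W) d → zero Sub.∈ s × s Sub.⊆ true ∷ W × ∣ s ∣ ≡ suc d
  from s∈ with ∈-map⁻ _ s∈
  ... | s′ , s′∈ , refl = let s⊆ , ∣s∣ = ∈-subsetsOf⁻ W d s′∈ in here , Sub.in⊆in s⊆ , cong suc ∣s∣

-- Covers and the extremal families

length-concatMap : ∀ (f : X → List Y) b xs → (∀ {x} → x ∈ xs → length (f x) ≡ b) → length (concatMap f xs) ≡ length xs * b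
length-concatMap f b [] _ = refl
length-concatMap f b (x ∷ xs) eq = trans (length-++ (f x))
  (cong₂ _+_ (eq (here refl)) (length-concatMap f b xs (eq ∘ there)))

minimal : {P : ℕ → Set} → Decidable P → ∀ {m} → P m → ∃ λ a → a ≤ m × P a × (∀ i → i < a → ¬ P i)
minimal {P} P? {m} Pm with search m
  where
  search : ∀ m → (∃ λ a → a < m × P a × (∀ i → i < a → ¬ P i)) ⊎ (∀ i → i < m → ¬ P i)
  search zero = inj₂ λ _ ()
  search (suc m) with search m
  ... | inj₁ (a , a<m , found) = inj₁ (a , m<n⇒m<1+n a<m , found)
  ... | inj₂ none with P? m
  ...   | yes Pm = inj₁ (m , ≤-refl , Pm , none)
  ...   | no ¬Pm = inj₂ λ i i<1+m → case i (m≤n⇒m<n∨m≡n (s≤s⁻¹ i<1+m))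
    where
    case : ∀ i → i < m ⊎ i ≡ m → ¬ P i
    case i (inj₁ i<m) = none i i<m
    case i (inj₂ refl) = ¬Pm
... | inj₁ (a , a<m , found) = a , <⇒≤ a<m , found
... | inj₂ none = m , ≤-refl , Pm , none

-- There are finitely many lists of a fixed length over the finite type of subsets. This makes the
-- least size of a cover computable.
anyList? : ∀ j {P : List (Subset n) → Set} → Decidable P → Dec (∃ λ Ts → length Ts ≡ j × P Ts)
anyList? zero P? = map′ (λ p → [] , refl , p) (λ { ([] , _ , p) → p }) (P? [])
anyList? (suc j) P? = map′
  (λ (s , Ts , eq , p) → s ∷ Ts , cong suc eq , p)
  (λ { (s ∷ Ts , eq , p) → s , Ts , suc-injective eq , p })
  (Sub.anySubset? λ s → anyList? j λ Ts → P? (s ∷ Ts))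

disjoint? : (s : Subset n) → Decidable (Disjoint s)
disjoint? s s′ = (s ∩ s′) ≟ˢ ⊥

-- A filter that does not shorten a list returns the list itself.
common-full : {Ts : List (Subset n)} {A : SetOfSubsets n} → length Ts ≤ common Ts A → Contains Ts A
common-full {Ts = Ts} {A} le = subst (λ Us → Contains Us A)
  (filter-complete Mem? (≤-antisym (length-filter Mem? Ts) le)) (All.all-filter Mem? Ts)
  where
  Mem? = λ s → ∋? s A

size-⊓≤common : (A B : SetOfSubsets n) {Ts : List (Subset n)} →
  (∀ {s} → s ∈ elems (A ⊓ B) → s ∈ Ts) → size (A ⊓ B) ≤ common Ts B
size-⊓≤common A B {Ts} sub = ≤-trans (≤-reflexive (sym (length-elems (A ⊓ B))))
  (Unique-⊆⇒length-≤ (elems-Unique (A ⊓ B)) λ s∈ → ∈-filter⁺ (λ s → ∋? s B) (sub s∈) (proj₂ (⊓-∋⁻ A B (∈-elems⁻ (A ⊓ B) s∈))))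

-- Partitions extending a packing

module Partitions (d k : ℕ) where

  c N : ℕ
  c = suc d
  N = c * k

  Partition : SetOfSubsets N → Set
  Partition = InU N c k

  Packing-length : {Ts : List (Subset N)} → Packing c Ts → length Ts ≤ k
  Packing-length {Ts} pack = *-cancelʳ-≤ (length Ts) k c (begin
    length Ts * c  ≡⟨ ∣⋃∣-Packing pack ⟨
    ∣ ⋃ Ts ∣       ≤⟨ Sub.∣p∣≤n (⋃ Ts) ⟩
    c * k          ≡⟨ *-comm c k ⟩
    k * c          ∎)
    where open ≤-Reasoning

  -- Disjointness makes the k blocks of size c occupy ck points, that is, the whole ground set.
  Partition-covers : ∀ {A} → Partition A → ∀ x → ∃ λ s → A ∋ s ≡ true × x Sub.∈ s
  Partition-covers {A} PA@(_ , _ , size≡k) x =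
    let s , s∈ , x∈s = ∈-⋃⁻ (elems A) (subst (x Sub.∈_) (sym full) Sub.∈⊤) in s , ∈-elems⁻ A s∈ , x∈s
    where
    full : ⋃ (elems A) ≡ ⊤
    full = Sub.∣p∣≡n⇒p≡⊤ (trans (∣⋃∣-Packing (elems-Packing PA))
      (trans (cong (_* c) (trans (length-elems A) size≡k)) (*-comm k c)))

  uncovered : List (Subset N) → Subset N
  uncovered Ts = ∁ (⋃ Ts)

  ⊆-uncovered⁺ : ∀ {s Ts} → All (Disjoint s) Ts → s Sub.⊆ uncovered Ts
  ⊆-uncovered⁺ {Ts = Ts} dis x∈s = Sub.x∉p⇒x∈∁p λ x∈⋃ →
    let s′ , s′∈ , x∈s′ = ∈-⋃⁻ Ts x∈⋃ in Disjoint-⁻ (All.lookup dis s′∈) x∈s x∈s′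

  ⊆-uncovered⁻ : ∀ {s Ts} → s Sub.⊆ uncovered Ts → All (Disjoint s) Ts
  ⊆-uncovered⁻ s⊆ = All.tabulate λ s′∈ → Disjoint-⁺ λ x∈s x∈s′ → Sub.x∈∁p⇒x∉p (s⊆ x∈s) (∈-⋃⁺ s′∈ x∈s′)

  ∣uncovered∣ : ∀ {Ts p} → Packing c Ts → length Ts + suc p ≡ k → ∣ uncovered Ts ∣ ≡ suc (d + suc d * p)
  ∣uncovered∣ {Ts} {p} pack len = begin
    ∣ ∁ (⋃ Ts) ∣                           ≡⟨ Sub.∣∁p∣≡n∸∣p∣ (⋃ Ts) ⟩
    c * k ∸ ∣ ⋃ Ts ∣                       ≡⟨ cong₂ (λ x y → c * x ∸ y) (sym len) (∣⋃∣-Packing pack) ⟩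
    c * (length Ts + suc p) ∸ length Ts * c ≡⟨ cong₂ _∸_ (*-distribˡ-+ c (length Ts) (suc p)) (*-comm (length Ts) c) ⟩
    c * length Ts + c * suc p ∸ c * length Ts ≡⟨ m+n∸m≡n (c * length Ts) (c * suc p) ⟩
    c * suc p                              ≡⟨ *-suc c p ⟩
    c + c * p                              ∎
    where open ≡-Reasoning

  -- Branching at the least uncovered point: a partition containing `Ts` has exactly one block
  -- there, so it follows exactly one branch.
  nextBlocks : List (Subset N) → List (Subset N)
  nextBlocks Ts = leastBlocks (uncovered Ts) d

  length-nextBlocks : ∀ {Ts p} → Packing c Ts → length Ts + suc p ≡ k → length (nextBlocks Ts) ≡ blockCount d p
  length-nextBlocks {Ts} pack len = length-leastBlocks (uncovered Ts) d (∣uncovered∣ pack len)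

  nextBlocks-Packing : ∀ {Ts p s} → Packing c Ts → length Ts + suc p ≡ k → s ∈ nextBlocks Ts → Packing c (s ∷ Ts)
  nextBlocks-Packing {Ts} pack len s∈ with ∈-leastBlocks (uncovered Ts) d (∣uncovered∣ pack len)
  ... | _ , _ , _ , from = let _ , s⊆ , ∣s∣ = from s∈ in Packing-∷ ∣s∣ (⊆-uncovered⁻ s⊆) pack

  -- Induction on the number p of missing blocks: the block through the least uncovered point is one
  -- of `blockCount d p` candidates.
  star-bound : ∀ p Ts → Packing c Ts → length Ts + p ≡ k →
    AtMost (partitionCount d p) (λ A → Partition A × Contains Ts A)
  star-bound zero Ts pack len = AtMost-1 λ (PA , CA) (PB , CB) → ⊑-antisym (sub PA CA CB) (sub PB CB CA)
    where
    sub : ∀ {A B} → Partition A → Contains Ts A → Contains Ts B → A ⊑ B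
    sub PA CA CB s A∋s with s ∈ˢ? Ts
    ... | yes s∈ = All.lookup CB s∈
    -- A block outside `Ts` would give a packing of k + 1 blocks.
    ... | no s∉ = ⊥-elim (1+n≰n (≤-trans
      (Packing-length (Packing-∷ (proj₁ PA s A∋s) (InU-Disjoint PA A∋s s∉ CA) pack))
      (≤-reflexive (trans (sym len) (+-identityʳ _)))))
  star-bound (suc p) Ts pack len = subst (λ x → AtMost (x * partitionCount d p) (λ A → Partition A × Contains Ts A))
    (length-nextBlocks pack len)
    (AtMost-⋃ ∋? (nextBlocks Ts) cov λ {s} s∈ → AtMost-⊆ (λ ((PA , CA) , A∋s) → PA , A∋s ∷ CA)
      (star-bound p (s ∷ Ts) (nextBlocks-Packing pack len s∈) (trans (sym (+-suc _ p)) len)))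
    where
    cov : ∀ {A} → Partition A × Contains Ts A → ∃ λ s → s ∈ nextBlocks Ts × A ∋ s ≡ true
    cov (PA , CA) with ∈-leastBlocks (uncovered Ts) d (∣uncovered∣ pack len)
    ... | x , x∈W , into , _ with Partition-covers PA x
    ...   | s , A∋s , x∈s = s ,
      into (⊆-uncovered⁺ (InU-Disjoint PA A∋s (λ s∈ → Sub.x∈∁p⇒x∉p x∈W (∈-⋃⁺ s∈ x∈s)) CA)) (proj₁ PA s A∋s) x∈s ,
      A∋s

  -- The branching of `star-bound` run as an enumeration. It produces the star that attains the
  -- bound.
  completions : ℕ → List (Subset N) → List (SetOfSubsets N)
  completions zero Ts = [ fromList Ts ]
  completions (suc p) Ts = concatMap (λ s → completions p (s ∷ Ts)) (nextBlocks Ts)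

  length-completions : ∀ p Ts → Packing c Ts → length Ts + p ≡ k → length (completions p Ts) ≡ partitionCount d p
  length-completions zero Ts pack len = refl
  length-completions (suc p) Ts pack len = trans
    (length-concatMap _ (partitionCount d p) (nextBlocks Ts) λ {s} s∈ →
      length-completions p (s ∷ Ts) (nextBlocks-Packing pack len s∈) (trans (sym (+-suc _ p)) len))
    (cong (_* partitionCount d p) (length-nextBlocks pack len))

  completions-sound : ∀ p Ts → Packing c Ts → length Ts + p ≡ k → ∀ {A} → A ∈ completions p Ts → Partition A × Contains Ts A
  completions-sound zero Ts pack len (here refl) =
    subst (λ ℓ → InU N c ℓ (fromList Ts)) (trans (sym (+-identityʳ _)) len) (InU-fromList pack) ,
    All.tabulate ∈-fromList⁺
  completions-sound (suc p) Ts pack len A∈ with find (∈-concatMap⁻ (λ s → completions p (s ∷ Ts)) {xs = nextBlocks Ts} A∈)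
  ... | s , s∈ , A∈′ with completions-sound p (s ∷ Ts) (nextBlocks-Packing pack len s∈) (trans (sym (+-suc _ p)) len) A∈′
  ...   | PA , _ ∷ CA = PA , CA

  -- A partition in two branches would have two distinct blocks through the same least uncovered
  -- point.
  completions-Unique : ∀ p Ts → Packing c Ts → length Ts + p ≡ k → Unique (completions p Ts)
  completions-Unique zero Ts pack len = [] ∷ []
  completions-Unique (suc p) Ts pack len = Unique.concat⁺
    (All.map⁺ (All.tabulate λ {s} s∈ → completions-Unique p (s ∷ Ts) (nextBlocks-Packing pack len s∈) len′))
    (AllPairs.map⁺ (Unique⇒AllPairs (leastBlocks-Unique (uncovered Ts) d) apart))
    where
    len′ : suc (length Ts) + p ≡ k
    len′ = trans (sym (+-suc _ p)) len
    apart : ∀ {s s′} → s ∈ nextBlocks Ts → s′ ∈ nextBlocks Ts → s ≢ s′ →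
      ∀ {A} → ¬ (A ∈ completions p (s ∷ Ts) × A ∈ completions p (s′ ∷ Ts))
    apart {s} {s′} s∈ s′∈ s≢s′ (A∈ , A∈′)
      with completions-sound p (s ∷ Ts) (nextBlocks-Packing pack len s∈) len′ A∈
         | completions-sound p (s′ ∷ Ts) (nextBlocks-Packing pack len s′∈) len′ A∈′
         | ∈-leastBlocks (uncovered Ts) d (∣uncovered∣ pack len)
    ... | PA , A∋s ∷ _ | _ , A∋s′ ∷ _ | _ , _ , _ , from =
      Disjoint-⁻ (proj₁ (proj₂ PA) s s′ A∋s A∋s′ s≢s′) (proj₁ (from s∈)) (proj₁ (from s′∈))

  -- Greedy construction: while fewer than k blocks are chosen, the list of next blocks has positive
  -- length.
  packing-exists : ∀ j → j ≤ k → ∃ λ (Ts : List (Subset N)) → length Ts ≡ j × Packing c Ts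
  packing-exists zero _ = [] , refl , [] , []
  packing-exists (suc j) j<k with packing-exists j (<⇒≤ j<k)
  ... | Ts , refl , pack = pick (nextBlocks Ts) (length-nextBlocks pack len) (nextBlocks-Packing pack len)
    where
    len : length Ts + suc (k ∸ suc (length Ts)) ≡ k
    len = trans (+-suc _ _) (m+[n∸m]≡n j<k)
    pick : ∀ (Bs : List (Subset N)) {p} → length Bs ≡ blockCount d p → (∀ {s} → s ∈ Bs → Packing c (s ∷ Ts)) →
      ∃ λ (Us : List (Subset N)) → length Us ≡ suc (length Ts) × Packing c Us
    pick [] {p} eq _ = ⊥-elim (1+n≰n (≤-trans (1≤blockCount d p) (≤-reflexive (sym eq))))
    pick (s ∷ _) _ packs = s ∷ Ts , refl , packs (here refl)

  -- At most q blocks of F are disjoint from Ts, and every A uses one of them.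
  extension-bound : ∀ {b t q} {P : SetOfSubsets N → Set} {F Ts} →
    Packing c Ts → length Ts + q ≡ k → Partition F → common Ts F < t →
    (∀ {A} → P A → Partition A × Contains Ts A × t ≤ size (A ⊓ F)) →
    (∀ {s} → Packing c (s ∷ Ts) → AtMost b (λ A → P A × A ∋ s ≡ true)) →
    AtMost (q * b) P
  extension-bound {b} {t} {q} {P} {F} {Ts} pack len PF few info bound =
    AtMost-≤ (*-monoˡ-≤ b length-candidates) (AtMost-⋃ ∋? candidates cov λ s∈ →
      let s∈F , dis = ∈-filter⁻ free? s∈ in bound (Packing-∷ (proj₁ PF _ (∈-elems⁻ F s∈F)) dis pack))
    where
    free? : Decidable (λ s → All (Disjoint s) Ts)
    free? s = All.all? (disjoint? s) Ts
    candidates = filter free? (elems F)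
    candidates-Packing : Packing c (candidates ++ Ts)
    candidates-Packing =
      All.++⁺ (All.filter⁺ free? (proj₁ (elems-Packing PF))) (proj₁ pack) ,
      AllPairs.++⁺ (AllPairs.filter⁺ free? (proj₂ (elems-Packing PF))) (proj₂ pack) (All.all-filter free? (elems F))
    -- The candidates together with `Ts` form a packing, which has at most k blocks.
    length-candidates : length candidates ≤ q
    length-candidates = +-cancelˡ-≤ (length Ts) _ _ (begin
      length Ts + length candidates  ≡⟨ +-comm (length Ts) _ ⟩
      length candidates + length Ts  ≡⟨ length-++ candidates ⟨
      length (candidates ++ Ts)      ≤⟨ Packing-length candidates-Packing ⟩
      k                              ≡⟨ len ⟨
      length Ts + q                  ∎)
      where open ≤-Reasoning
    cov : ∀ {A} → P A → ∃ λ s → s ∈ candidates × A ∋ s ≡ true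
    cov {A} pA with info pA | All.all? (_∈ˢ? Ts) (elems (A ⊓ F))
    -- If all common blocks of A and F lay in `Ts`, then `Ts` would share at least t blocks with F.
    ... | _ , _ , t≤ | yes all = ⊥-elim (<⇒≱ few (≤-trans t≤ (size-⊓≤common A F (All.lookup all))))
    ... | PA , CA , _ | no ¬all with find (All.¬All⇒Any¬ (_∈ˢ? Ts) _ ¬all)
    ...   | s , s∈ , s∉ =
      let A∋s , F∋s = ⊓-∋⁻ A F (∈-elems⁻ (A ⊓ F) s∈)
      in s , ∈-filter⁺ free? (∈-elems⁺ F F∋s) (InU-Disjoint PA A∋s s∉ CA) , A∋s

  -- Runs through S and decides for each block whether A contains it; the two counts add up by
  -- Pascal's rule. `Ts` collects the blocks chosen so far and r counts those still to be chosen;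
  -- disjointness from S keeps every choice a packing.
  cover-split : ∀ {b} {P : SetOfSubsets N → Set} S r Ts → Packing c Ts → Packing c S → All (λ s → All (Disjoint s) Ts) S →
    (∀ Us → Packing c Us → length Us ≡ r + length Ts → AtMost b (λ A → P A × Contains Us A)) →
    AtMost ((length S C r) * b) (λ A → (P A × Contains Ts A) × r ≤ common S A)
  cover-split {b} S zero Ts packT packS dis bound =
    AtMost-≤ (≤-reflexive (sym (*-identityˡ b))) (AtMost-⊆ proj₁ (bound Ts packT refl))
  cover-split [] (suc r) Ts packT packS dis bound [] _ _ = z≤n
  cover-split [] (suc r) Ts packT packS dis bound (x ∷ xs) _ all with all (here refl)
  ... | _ , ()
  cover-split {b} {P} (s ∷ S) (suc r) Ts packT (∣s∣ ∷ sizes , disS ∷ pairs) (disT ∷ dis) bound =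
    AtMost-≤ (≤-reflexive (trans (sym (*-distribʳ-+ b (length S C r) _))
                                 (cong (_* b) (nCk+nC[k+1]≡[n+1]C[k+1] (length S) r))))
      (AtMost-+ (∋? s)
        (AtMost-⊆ (λ {A} → with-s {A})
          (cover-split S r (s ∷ Ts) (Packing-∷ ∣s∣ disT packT) (sizes , pairs)
            (All.zipWith (λ (s∥s′ , s′∥Ts) → Disjoint-sym s∥s′ ∷ s′∥Ts) (disS , dis))
            (λ Us packU lenU → bound Us packU (trans lenU (+-suc r _)))))
        (AtMost-⊆ (λ {A} → without-s {A})
          (cover-split S (suc r) Ts packT (sizes , pairs) dis bound)))
    where
    with-s : ∀ {A} → ((P A × Contains Ts A) × suc r ≤ common (s ∷ S) A) × A ∋ s ≡ true →
      (P A × Contains (s ∷ Ts) A) × r ≤ common S A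
    with-s {A} (((pA , CA) , le) , A∋s) =
      (pA , A∋s ∷ CA) , s≤s⁻¹ (subst (suc r ≤_) (cong length (filter-accept (λ s → ∋? s A) A∋s)) le)
    without-s : ∀ {A} → ((P A × Contains Ts A) × suc r ≤ common (s ∷ S) A) × ¬ (A ∋ s ≡ true) →
      (P A × Contains Ts A) × suc r ≤ common S A
    without-s {A} ((pCA , le) , A∌s) = pCA , subst (suc r ≤_) (cong length (filter-reject (λ s → ∋? s A) A∌s)) le

  HasCover : ℕ → List (SetOfSubsets N) → ℕ → Set
  HasCover t 𝓗 j = ∃ λ Ts → length Ts ≡ j × Packing c Ts × All (λ H → t ≤ common Ts H) 𝓗

  hasCover? : ∀ t 𝓗 → Decidable (HasCover t 𝓗)
  hasCover? t 𝓗 j = anyList? j λ Ts →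
    (All.all? (λ s → ∣ s ∣ ≟ c) Ts ×-dec AllPairs.allPairs? disjoint? Ts) ×-dec All.all? (λ H → t ≤? common Ts H) 𝓗

  Crossing : ℕ → List (SetOfSubsets N) → SetOfSubsets N → Set
  Crossing t 𝓗 A = Partition A × All (λ H → t ≤ size (A ⊓ H)) 𝓗

  -- `Ts` has i blocks beyond the first t, and j more are to be forced. While i < a it is not a
  -- cover, so some H misses it enough to force a further block with at most k - |Ts| = j + p
  -- choices. At j = 0 the remaining p blocks are free.
  crossing-star-bound : ∀ {t 𝓗 a} → All Partition 𝓗 → (∀ i → i < a → ¬ HasCover t 𝓗 (i + t)) →
    ∀ i j p Ts → i + j ≡ a → Packing c Ts → length Ts ≡ i + t → length Ts + (j + p) ≡ k →
    AtMost (falling j p * partitionCount d p) (λ A → Crossing t 𝓗 A × Contains Ts A)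
  crossing-star-bound parts none i zero p Ts _ pack _ len =
    AtMost-≤ (≤-reflexive (sym (*-identityˡ _))) (AtMost-⊆ (λ ((PA , _) , CA) → PA , CA) (star-bound p Ts pack len))
  crossing-star-bound {t} {𝓗} {a} parts none i (suc j) p Ts i+j pack lenT len with All.all? (λ H → t ≤? common Ts H) 𝓗
  ... | yes cover = ⊥-elim (none i (m+n≤o⇒m≤o (suc i) (≤-reflexive (trans (sym (+-suc i j)) i+j))) (Ts , lenT , pack , cover))
  ... | no ¬cover with find (All.¬All⇒Any¬ (λ H → t ≤? common Ts H) 𝓗 ¬cover)
  ...   | H , H∈ , t≰ = AtMost-≤ (≤-reflexive (sym (*-assoc (suc (j + p)) (falling j p) _)))
    (extension-bound {t = t} pack len (All.lookup parts H∈) (≰⇒> t≰)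
      (λ ((PA , cross) , CA) → PA , CA , All.lookup cross H∈)
      (λ {s} pack′ → AtMost-⊆ (λ ((crossing , CA) , A∋s) → crossing , A∋s ∷ CA)
        (crossing-star-bound parts none (suc i) j p (s ∷ Ts) (trans (sym (+-suc i j)) i+j) pack′ (cong suc lenT)
          (trans (sym (+-suc _ (j + p))) len))))

  -- The two parameters come from different families: b from a cover of 𝓐 itself, giving the
  -- binomial, and a from the absence of small covers of 𝓗, giving the falling product.
  crossing-bound : ∀ {t 𝓗 𝓐 a b p} → All Partition 𝓗 → (∀ i → i < a → ¬ HasCover t 𝓗 (i + t)) →
    Unique 𝓐 → All (Crossing t 𝓗) 𝓐 → HasCover t 𝓐 (b + t) → t + (a + p) ≡ k →
    length 𝓐 ≤ ((b + t) C t) * (falling a p * partitionCount d p)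
  crossing-bound {t} {𝓗} {𝓐} {a} {b} {p} parts none uniq cross (S , lenS , packS , cover) len =
    subst (λ x → length 𝓐 ≤ (x C t) * (falling a p * partitionCount d p)) lenS
      (cover-split S t [] ([] , []) packS (All.tabulate λ _ → [])
        (λ Us packU lenU → crossing-star-bound parts none 0 a p Us refl packU
          (trans lenU (+-identityʳ t)) (trans (cong (_+ (a + p)) (trans lenU (+-identityʳ t))) len))
        𝓐 uniq (λ A∈ → (All.lookup cross A∈ , []) , All.lookup cover A∈))

  -- The blocks of a single crossing partition already form a cover, which bounds the search for a
  -- smallest one.
  member-cover : ∀ {t 𝓗 A} → Crossing t 𝓗 A → HasCover t 𝓗 k
  member-cover {A = A} (PA , cross) = elems A , trans (length-elems A) (proj₂ (proj₂ PA)) , elems-Packing PA ,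
    All.map (λ {H} t≤ → ≤-trans t≤ (size-⊓≤common A H λ s∈ → ∈-elems⁺ A (proj₁ (⊓-∋⁻ A H (∈-elems⁻ (A ⊓ H) s∈))))) cross

  open import Data.List.Membership.DecPropositional (_≟ᵀ_ {N}) using (_∈?_)

  -- A missing member of the star could be added to 𝓐, exceeding the size bound for the star.
  full-star : ∀ {p Ts 𝓐} → Packing c Ts → length Ts + p ≡ k → Unique 𝓐 → All (λ A → Partition A × Contains Ts A) 𝓐 →
    partitionCount d p ≤ length 𝓐 → ∀ {A} → Partition A × Contains Ts A → A ∈ 𝓐
  full-star {p} {Ts} {𝓐} pack len uniq all full {A} star with A ∈? 𝓐
  ... | yes A∈ = A∈
  ... | no A∉ = ⊥-elim (1+n≰n (≤-trans
    (star-bound p Ts pack len (A ∷ 𝓐) (All.¬Any⇒All¬ 𝓐 A∉ ∷ uniq) (All.lookup (star ∷ all))) full))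

  star-cross : ∀ {p t Ts} → Packing c Ts → length Ts ≡ t → length Ts + p ≡ k → CrossInt t (completions p Ts) (completions p Ts)
  star-cross {p} {t} {Ts} pack lenT len = All.tabulate λ {A} A∈ → All.tabulate λ {B} B∈ → begin
    t                       ≡⟨ lenT ⟨
    length Ts               ≤⟨ Unique-⊆⇒length-≤ (Packing-Unique pack) (λ s∈ → ∈-elems⁺ (A ⊓ B) (⊓-∋⁺ A B
                                 (All.lookup (proj₂ (completions-sound p Ts pack len A∈)) s∈)
                                 (All.lookup (proj₂ (completions-sound p Ts pack len B∈)) s∈))) ⟩
    length (elems (A ⊓ B))  ≡⟨ length-elems (A ⊓ B) ⟩
    size (A ⊓ B)            ∎
    where open ≤-Reasoning

-- Extremal pairs of cross-intersecting families

theorem1p1 : (c k t : ℕ) → c ≥ 3 → t ≥ 1 → k ≥ t + 2 →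
    (𝓕 𝓖 : List (SetOfSubsets (c * k))) →
    Family (c * k) c k 𝓕 → Family (c * k) c k 𝓖 → CrossInt t 𝓕 𝓖 →
    ((𝓕' 𝓖' : List (SetOfSubsets (c * k))) →
    Family (c * k) c k 𝓕' → Family (c * k) c k 𝓖' → CrossInt t 𝓕' 𝓖' →
    length 𝓕' * length 𝓖' ≤ length 𝓕 * length 𝓖) →
    (t * t ≤ 2 ^ (c ∸ 3) ⊎ k ≥ 2 * t + 2) →
    Σ (SetOfSubsets (c * k)) (λ T → InU (c * k) c t T ×
    ((A : SetOfSubsets (c * k)) →
    ((A ∈ 𝓕) ⇔ (InU (c * k) c k A × T ⊑ A)) ×
    ((A ∈ 𝓖) ⇔ (InU (c * k) c k A × T ⊑ A))))
theorem1p1 1 k t (s≤s ())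
theorem1p1 2 k t (s≤s (s≤s ()))
theorem1p1 c@(suc (suc (suc e))) k t _ _ k≥t+2 𝓕 𝓖 (uniqF , partF) (uniqG , partG) cross maximum hyp =
  conclude (minimal (λ a → hasCover? t 𝓕 (a + t)) coverF) (minimal (λ b → hasCover? t 𝓖 (b + t)) coverG)
  where
  d = 2 + e
  open Partitions d k hiding (c)

  m U : ℕ
  m = k ∸ t
  U = partitionCount d m

  t+m≡k : t + m ≡ k
  t+m≡k = m+[n∸m]≡n (≤-trans (m≤m+n t 2) k≥t+2)

  2≤m : 2 ≤ m
  2≤m = m+n≤o⇒m≤o∸n 2 (subst (_≤ k) (+-comm t 2) k≥t+2)

  small : t * t ≤ 2 ^ e ⊎ t < m
  -- From k ≥ 2t + 2 it follows that t + 1 ≤ k - t = m.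
  small = map₂ (λ k≥ → m+n≤o⇒m≤o∸n (suc t) (≤-trans (≤-trans (m≤m+n _ 1) (≤-reflexive (double t))) k≥)) hyp
    where
    double : ∀ t → suc t + t + 1 ≡ 2 * t + 2
    double = solve-∀

  bound< : ∀ a p → a + p ≡ m → 1 ≤ a → coverBound d t a p < U
  bound< = coverBound<partitionCount e t m 2≤m small

  bound≤ : ∀ a p → a + p ≡ m → coverBound d t a p ≤ U
  bound≤ zero p refl = ≤-reflexive (coverBound-zero d t p)
  bound≤ (suc a) p eq = <⇒≤ (bound< (suc a) p eq (s≤s z≤n))

  -- Maximality is tested against the pair formed by one star taken twice.
  U*U≤ : U * U ≤ length 𝓕 * length 𝓖
  U*U≤ with packing-exists t (≤-trans (m≤m+n t 2) k≥t+2)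
  ... | Ts , lenT , pack = subst (λ x → x * x ≤ length 𝓕 * length 𝓖) (length-completions m Ts pack len)
    (maximum star star family family (star-cross pack lenT len))
    where
    len : length Ts + m ≡ k
    len = trans (cong (_+ m) lenT) t+m≡k
    star = completions m Ts
    family : Family _ c k star
    family = completions-Unique m Ts pack len , All.tabulate (proj₁ ∘ completions-sound m Ts pack len)

  crossingF : All (Crossing t 𝓖) 𝓕
  crossingF = All.zip (partF , cross)

  crossingG : All (Crossing t 𝓕) 𝓖
  crossingG = All.tabulate λ {G} G∈ → All.lookup partG G∈ ,
    All.tabulate λ {F} F∈ → subst (t ≤_) (size-⊓-comm F G) (All.lookup (All.lookup cross F∈) G∈)

  some-cover : ∀ {𝓐 𝓗} → All (Crossing t 𝓗) 𝓐 → 1 ≤ length 𝓐 → HasCover t 𝓗 (m + t)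
  some-cover (crossing ∷ _) _ = subst (HasCover t _) (trans (sym t+m≡k) (+-comm t m)) (member-cover crossing)

  1≤F*G : 1 ≤ length 𝓕 * length 𝓖
  1≤F*G = ≤-trans (*-mono-≤ (1≤partitionCount d m) (1≤partitionCount d m)) U*U≤

  -- The product of the sizes is positive, so 𝓖 is nonempty, and any member of it covers 𝓕 with k =
  -- m + t blocks.
  coverF : HasCover t 𝓕 (m + t)
  coverF = some-cover crossingG (n≢0⇒n>0 λ G≡0 →
    1+n≰n (≤-trans 1≤F*G (≤-reflexive (trans (cong (length 𝓕 *_) G≡0) (*-zeroʳ (length 𝓕))))))

  coverG : HasCover t 𝓖 (m + t)
  coverG = some-cover crossingF (n≢0⇒n>0 λ F≡0 →
    1+n≰n (≤-trans 1≤F*G (≤-reflexive (cong (_* length 𝓖) F≡0))))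

  Minimal : List (SetOfSubsets (c * k)) → Set
  Minimal 𝓗 = ∃ λ a → a ≤ m × HasCover t 𝓗 (a + t) × (∀ i → i < a → ¬ HasCover t 𝓗 (i + t))

  -- The bound for 𝓕 has its binomial in a and its falling product in b, the bound for 𝓖 the
  -- reverse. Exchanging these factors leaves one term in a alone and one in b alone.
  product-bound : ((a , _) : Minimal 𝓕) ((b , _) : Minimal 𝓖) →
    length 𝓕 * length 𝓖 ≤ coverBound d t a (m ∸ a) * coverBound d t b (m ∸ b)
  product-bound (a , a≤m , covF , noneF) (b , b≤m , covG , noneG) = begin
    length 𝓕 * length 𝓖     ≤⟨ *-mono-≤ (crossing-bound {p = m ∸ b} partG noneG uniqF crossingF covF (len b≤m))
                                        (crossing-bound {p = m ∸ a} partF noneF uniqG crossingG covG (len a≤m)) ⟩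
    x * y * (z * w)         ≡⟨ swap x y z w ⟩
    x * w * (z * y)         ∎
    where
    open ≤-Reasoning
    x = (a + t) C t
    y = falling b (m ∸ b) * partitionCount d (m ∸ b)
    z = (b + t) C t
    w = falling a (m ∸ a) * partitionCount d (m ∸ a)
    swap : ∀ x y z w → x * y * (z * w) ≡ x * w * (z * y)
    swap = solve-∀
    len : ∀ {a} → a ≤ m → t + (a + (m ∸ a)) ≡ k
    len a≤m = trans (cong (t +_) (m+[n∸m]≡n a≤m)) t+m≡k

  Goal : Set
  Goal = Σ (SetOfSubsets (c * k)) (λ T → InU (c * k) c t T ×
    ((A : SetOfSubsets (c * k)) →
    ((A ∈ 𝓕) ⇔ (InU (c * k) c k A × T ⊑ A)) ×
    ((A ∈ 𝓖) ⇔ (InU (c * k) c k A × T ⊑ A))))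

  1≤U : 1 ≤ U
  1≤U = 1≤partitionCount d m

  too-small : ∀ {x y} → x < U → y ≤ U → U * U ≰ x * y
  too-small {x} {y} x<U y≤U le = <⇒≱ (<-≤-trans (*-monoˡ-< U {{>-nonZero 1≤U}} x<U) le) (*-monoʳ-≤ x y≤U)

  -- A cover by exactly t blocks lies inside every member of 𝓕. As neither size exceeds U and the
  -- product is at least U², both sizes equal U, so each family fills the star once it is contained
  -- in it.
  star-case : length 𝓕 ≤ U → length 𝓖 ≤ U → HasCover t 𝓕 t → Goal
  star-case F≤U G≤U (Ts , lenT , pack , cover) = fromList Ts ,
    subst (λ ℓ → InU (c * k) c ℓ (fromList Ts)) lenT (InU-fromList pack) ,
    λ A → equivalence uniqF starF (≮⇒≥ λ F<U → too-small F<U G≤U U*U≤) ,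
          equivalence uniqG starG (≮⇒≥ λ G<U → too-small G<U F≤U (subst (U * U ≤_) (*-comm (length 𝓕) _) U*U≤))
    where
    len : length Ts + m ≡ k
    len = trans (cong (_+ m) lenT) t+m≡k

    starF : All (λ A → Partition A × Contains Ts A) 𝓕
    starF = All.zip (partF , All.map (λ {F} t≤ → common-full {A = F} (≤-trans (≤-reflexive lenT) t≤)) cover)

    -- Every F contains `Ts` and must share with G a block outside `Ts`; there are at most m such
    -- blocks, each leaving at most u(m - 1) partitions.
    F-small : ∀ {G} → G ∈ 𝓖 → common Ts G < t → length 𝓕 < U
    F-small {G} G∈ few = begin-strict
      length 𝓕                                        ≤⟨ extension-bound pack len (All.lookup partG G∈) few
                                                           (λ F∈ → let PF , CF = All.lookup starF F∈ in PF , CF , All.lookup (All.lookup cross F∈) G∈)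
                                                           (λ {s} pack′ → AtMost-⊆ (λ (F∈ , F∋s) → let PF , CF = All.lookup starF F∈ in PF , F∋s ∷ CF)
                                                             (star-bound p (s ∷ Ts) pack′ (trans (sym (+-suc _ p)) (trans (cong (length Ts +_) 1+p≡m) len))))
                                                           𝓕 uniqF (λ F∈ → F∈) ⟩
      m * partitionCount d p                          ≡⟨ cong (_* partitionCount d p) (trans (sym 1+p≡m) (sym (*-identityʳ (suc p)))) ⟩
      -- Multiplying by a positive binomial turns m u(m - 1) into h(1), which is already known to be
      -- below u(m).
      falling 1 p * partitionCount d p                ≤⟨ m≤n*m _ ((1 + t) C t) {{>-nonZero (1≤C 1 t)}} ⟩
      coverBound d t 1 p                              <⟨ bound< 1 p 1+p≡m ≤-refl ⟩
      U                                               ∎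
      where
      open ≤-Reasoning
      p = m ∸ 1
      1+p≡m : 1 + p ≡ m
      1+p≡m = m+[n∸m]≡n (<⇒≤ 2≤m)

    starG : All (λ A → Partition A × Contains Ts A) 𝓖
    starG = All.tabulate λ {G} G∈ → All.lookup partG G∈ , common-full {A = G} (≮⇒≥ λ few →
      too-small (F-small G∈ (subst (common Ts G <_) lenT few)) G≤U U*U≤)

    equivalence : ∀ {𝓐 A} → Unique 𝓐 → All (λ A → Partition A × Contains Ts A) 𝓐 → U ≤ length 𝓐 →
      (A ∈ 𝓐) ⇔ (InU (c * k) c k A × fromList Ts ⊑ A)
    equivalence uniq star U≤ = mk⇔
      (λ A∈ → let PA , CA = All.lookup star A∈ in PA , λ s T∋s → All.lookup CA (∈-fromList⁻ Ts T∋s))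
      (λ (PA , T⊑A) → full-star pack len uniq star U≤ (PA , All.tabulate λ s∈ → T⊑A _ (∈-fromList⁺ s∈)))

  conclude : Minimal 𝓕 → Minimal 𝓖 → Goal
  -- A positive excess for either family makes one factor of the product bound strictly smaller than
  -- U, against U² from the star.
  conclude minF@(suc a , a≤m , _) minG@(b , b≤m , _) = ⊥-elim (too-small
    (bound< (suc a) _ (m+[n∸m]≡n a≤m) (s≤s z≤n)) (bound≤ b _ (m+[n∸m]≡n b≤m))
    (≤-trans U*U≤ (product-bound minF minG)))
  conclude minF@(zero , a≤m , _) minG@(suc b , b≤m , _) = ⊥-elim (too-small
    (bound< (suc b) _ (m+[n∸m]≡n b≤m) (s≤s z≤n)) (bound≤ 0 _ refl)
    (≤-trans U*U≤ (≤-trans (product-bound minF minG) (≤-reflexive (*-comm (coverBound d t 0 m) _)))))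
  -- With both excesses zero, each family is bounded by h(0) = U.
  conclude (zero , _ , covF , noneF) (zero , _ , covG , noneG) = star-case
    (≤-trans (crossing-bound {p = m} partG noneG uniqF crossingF covF t+m≡k) (bound≤ 0 m refl))
    (≤-trans (crossing-bound {p = m} partF noneF uniqG crossingG covG t+m≡k) (bound≤ 0 m refl))
    covF
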